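{- Let $R\ge1$ be an integer. In any 2-XOR or max-cut instance, $R$-round Sherali--Adams cannot certify that $$\mathrm{OBJ}(x)<\frac12+\frac1{\pi R}-\frac1{2R^2}.$$ That is, let $G=(V,E)$ be a simple graph with at least one edge and with signs $b_{ij}=b_{ji}\in\{\pm1\}$ for $(i,j)\in E$ (all equal to $-1$ in the case of max-cut), and let $$\mathrm{OBJ}(X)=\frac1{|E|}\sum_{(i,j)\in E}\left(\frac12+\frac12b_{ij}X_iX_j\right);$$ then for no real $v<\frac12+\frac1{\pi R}-\frac1{2R^2}$ can the $R$-round Sherali--Adams proof system derive $\mathrm{OBJ}(X)\le v$.
   Context: Here $\pi=3.14159\ldots$. A 2-XOR instance consists of constraints $x_ix_jb_{ij}=1$ on the edges of $G$, and $\mathrm{OBJ}(x)$ for $x\in\{\pm1\}^V$ is the fraction of satisfied constraints. $R$-round Sherali--Adams proof system over indeterminates $X_v$, $v\in V$ (with Boolean equalities): the lines are real polynomial inequalities in $X$. The axioms are all inequalities $p(X)^2\ge0$ where $p$ is a real polynomial depending on at most $R$ indeterminates, and all inequalities $(X_u^2-1)s(X)\ge0$ and $(X_u^2-1)s(X)\le0$ where the polynomial $(X_u^2-1)s(X)$ depends on at most $R$ indeterminates. One may derive any nonnegative linear combination of previous lines. An inequality $p\le q$ is derived if the line $q-p\ge0$ is derived. -}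

module Defs where

open import Data.Bool.Base using (if_then_else_)
open import Data.Fin.Base using (Fin) renaming (_<_ to _<ᶠ_)
open import Data.Fin.Properties using () renaming (_<?_ to _<ᶠ?_)
open import Data.Fin.Subset using (Subset; _∉_) renaming (∣_∣ to card)
open import Data.Integer.Base as ℤ using (ℤ; +_)
import Data.Integer.Properties as ℤP
open import Data.List.Base
  using (List; []; _∷_; _++_; map; foldr; filter; length; applyUpTo;
         allFin; cartesianProduct; cartesianProductWith)
open import Data.List.Relation.Unary.All using (All)
open import Data.Nat.Base as ℕ using (ℕ; zero; suc; z≤n; s≤s; NonZero)
open import Data.Nat.ListAction using (sum)
import Data.Nat.Properties as ℕP
import Data.Nat.Solver as ℕS
open import Data.Product.Base using (_×_; _,_; ∃; ∃₂)
open import Data.Rational.Base as ℚ using (ℚ; 0ℚ; 1ℚ; ½; _/_)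
import Data.Rational.Properties as ℚP
import Data.Rational.Solver as ℚS
import Data.Rational.Unnormalised.Base as ℚᵘ
import Data.Rational.Unnormalised.Properties as ℚᵘP
open import Data.Sign.Base as Sign using (Sign)
open import Data.Sum.Base using (inj₁; inj₂)
open import Data.Vec.Base using (Vec; lookup; replicate; zipWith; _[_]≔_)
import Data.Vec.Properties as VecP
open import Function.Base using (_∘_)
open import Level using (0ℓ)
open import Relation.Binary.Core using (Rel)
open import Relation.Binary.Definitions using (Decidable; Symmetric)
open import Relation.Binary.PropositionalEquality
  using (_≡_; _≢_; refl; sym; trans; cong; cong₂; subst; subst₂)
open import Relation.Nullary.Decidable.Core using (does; _×-dec_)
open import Relation.Nullary.Negation.Core using (¬_; contradiction)

------------------------------------------------------------------------
-- quarterDisk N is the number of unit squares [i , i+1] × [j , j+1] with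
-- i, j ∈ ℕ that lie in the disk of radius N around the origin.

sumTo : ℕ → (ℕ → ℕ) → ℕ
sumTo n f = sum (applyUpTo f n)

cell : ℕ → ℕ → ℕ → ℕ
cell N i j = if i ℕ.* i ℕ.+ j ℕ.* j ℕ.≤ᵇ N ℕ.* N then 1 else 0

quarterDisk : ℕ → ℕ
quarterDisk N = sumTo N λ i → sumTo N λ j → cell N (suc i) (suc j)

module DiskCount where
  open import Data.Nat.Base
  open import Data.Nat.Properties
  open import Data.Bool.Base using (true; false; T)
  open ℕS.+-*-Solver

  sumTo-mono : ∀ n {f g} → (∀ i → i < n → f i ≤ g i) → sumTo n f ≤ sumTo n g
  sumTo-mono zero    h = z≤n
  sumTo-mono (suc n) h = +-mono-≤ (h 0 (s≤s z≤n)) (sumTo-mono n λ i i<n → h (suc i) (s≤s i<n))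

  sumTo-cong : ∀ n {f g} → (∀ i → f i ≡ g i) → sumTo n f ≡ sumTo n g
  sumTo-cong zero    h = refl
  sumTo-cong (suc n) h = cong₂ _+_ (h 0) (sumTo-cong n (h ∘ suc))

  sumTo-const : ∀ n c → sumTo n (λ _ → c) ≡ n * c
  sumTo-const zero    c = refl
  sumTo-const (suc n) c = cong (_+_ c) (sumTo-const n c)

  sumTo-* : ∀ n c f → sumTo n (λ i → c * f i) ≡ c * sumTo n f
  sumTo-* zero    c f = sym (*-zeroʳ c)
  sumTo-* (suc n) c f = trans (cong (_+_ (c * f 0)) (sumTo-* n c (f ∘ suc)))
    (sym (*-distribˡ-+ c (f 0) _))

  sumTo-+ : ∀ n f g → sumTo n (λ i → f i + g i) ≡ sumTo n f + sumTo n g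
  sumTo-+ zero    f g = refl
  sumTo-+ (suc n) f g = trans (cong (_+_ (f 0 + g 0)) (sumTo-+ n (f ∘ suc) (g ∘ suc)))
    (solve 4 (λ a b c d → (a :+ b) :+ (c :+ d) := (a :+ c) :+ (b :+ d)) refl
      (f 0) (g 0) (sumTo n (f ∘ suc)) (sumTo n (g ∘ suc)))

  sumTo-++ : ∀ m n f → sumTo (m + n) f ≡ sumTo m f + sumTo n (λ i → f (m + i))
  sumTo-++ zero    n f = refl
  sumTo-++ (suc m) n f = trans (cong (_+_ (f 0)) (sumTo-++ m n (f ∘ suc)))
    (sym (+-assoc (f 0) _ _))

  sumTo-blocks : ∀ N M f → sumTo (N * M) f ≡ sumTo N λ i → sumTo M λ r → f (i * M + r)
  sumTo-blocks zero    M f = refl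
  sumTo-blocks (suc N) M f = trans (sumTo-++ M (N * M) f)
    (cong (_+_ (sumTo M f)) (trans (sumTo-blocks N M (λ k → f (M + k)))
      (sumTo-cong N λ i → sumTo-cong M λ r → cong f (sym (+-assoc M (i * M) r)))))

  sumTo²-blocks : ∀ N M (g : ℕ → ℕ → ℕ) →
    sumTo (N * M) (λ p → sumTo (N * M) (g p)) ≡
    sumTo N λ i → sumTo M λ r → sumTo N λ j → sumTo M λ s → g (i * M + r) (j * M + s)
  sumTo²-blocks N M g = trans (sumTo-blocks N M _)
    (sumTo-cong N λ i → sumTo-cong M λ r → sumTo-blocks N M (g (i * M + r)))

  sumTo²-const : ∀ N M (g : ℕ → ℕ → ℕ) →
    (sumTo N λ i → sumTo M λ r → sumTo N λ j → sumTo M λ s → g i j) ≡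
    M * M * (sumTo N λ i → sumTo N λ j → g i j)
  sumTo²-const N M g = trans
    (sumTo-cong N λ i → trans
      (sumTo-cong M λ r → trans (sumTo-cong N λ j → sumTo-const M (g i j))
        (sumTo-* N M (g i)))
      (trans (sumTo-const M _) (sym (*-assoc M M _))))
    (sumTo-* N (M * M) _)

  cell-mono : ∀ N i j N′ i′ j′ →
    (i * i + j * j ≤ N * N → i′ * i′ + j′ * j′ ≤ N′ * N′) →
    cell N i j ≤ cell N′ i′ j′
  cell-mono N i j N′ i′ j′ h
    with i * i + j * j ≤ᵇ N * N in eq | i′ * i′ + j′ * j′ ≤ᵇ N′ * N′ in eq′
  ... | false | _     = z≤n
  ... | true  | true  = ≤-refl
  ... | true  | false = contradiction
    (subst T eq′ (≤⇒≤ᵇ (h (≤ᵇ⇒≤ _ _ (subst T (sym eq) _))))) λ ()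

  cell≤1 : ∀ N i j → cell N i j ≤ 1
  cell≤1 N i j with i * i + j * j ≤ᵇ N * N
  ... | false = z≤n
  ... | true  = ≤-refl

  scale : ∀ i j M → (i * M) * (i * M) + (j * M) * (j * M) ≡ (i * i + j * j) * (M * M)
  scale = solve 3 (λ i j M → (i :* M) :* (i :* M) :+ (j :* M) :* (j :* M) :=
                             (i :* i :+ j :* j) :* (M :* M)) refl

  scale₁ : ∀ N M → (N * M) * (N * M) ≡ (N * N) * (M * M)
  scale₁ = solve 2 (λ N M → (N :* M) :* (N :* M) := (N :* N) :* (M :* M)) refl

  sq-mono : ∀ {a b c d} → a ≤ b → c ≤ d → a * a + c * c ≤ b * b + d * d
  sq-mono p q = +-mono-≤ (*-mono-≤ p p) (*-mono-≤ q q)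

  refine-lower : ∀ N M → M * M * quarterDisk N ≤ quarterDisk (N * M)
  refine-lower N M = subst₂ _≤_
    (sumTo²-const N M (λ i j → cell N (suc i) (suc j)))
    (sym (sumTo²-blocks N M (λ p q → cell (N * M) (suc p) (suc q))))
    (sumTo-mono N λ i _ → sumTo-mono M λ r r<M → sumTo-mono N λ j _ → sumTo-mono M λ s s<M →
      cell-mono N (suc i) (suc j) (N * M) (suc (i * M + r)) (suc (j * M + s)) λ h →
        ≤-trans (sq-mono (corner i r<M) (corner j s<M))
          (subst₂ _≤_ (sym (scale (suc i) (suc j) M)) (sym (scale₁ N M))
            (*-monoˡ-≤ (M * M) h)))
    where
      corner : ∀ i {r} → r < M → suc (i * M + r) ≤ suc i * M
      corner i {r} r<M = subst₂ _≤_ (+-suc (i * M) r) (+-comm (i * M) M)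
        (+-monoʳ-≤ (i * M) r<M)

  outer : ℕ → ℕ
  outer N = sumTo N λ i → sumTo N λ j → cell N i j

  refine-upper : ∀ N M .{{_ : NonZero M}} → quarterDisk (N * M) ≤ M * M * outer N
  refine-upper N M = subst₂ _≤_
    (sym (sumTo²-blocks N M (λ p q → cell (N * M) (suc p) (suc q))))
    (sumTo²-const N M (cell N))
    (sumTo-mono N λ i _ → sumTo-mono M λ r _ → sumTo-mono N λ j _ → sumTo-mono M λ s _ →
      cell-mono (N * M) (suc (i * M + r)) (suc (j * M + s)) N i j λ h →
        *-cancelʳ-≤ _ _ (M * M) {{m*n≢0 M M}}
          (subst₂ _≤_ (scale i j M) (scale₁ N M)
            (≤-trans (sq-mono (corner i r) (corner j s)) h)))
    where
      corner : ∀ i r → i * M ≤ suc (i * M + r)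
      corner i r = m≤n⇒m≤1+n (m≤m+n (i * M) r)

  sumTo-step : ∀ n f → sumTo n f ≤ sumTo (suc n) f
  sumTo-step zero    f = z≤n
  sumTo-step (suc n) f = +-monoʳ-≤ (f 0) (sumTo-step n (f ∘ suc))

  sumTo≤ : ∀ n f → (∀ i → f i ≤ 1) → sumTo n f ≤ n
  sumTo≤ n f h = subst (sumTo n f ≤_) (trans (sumTo-const n 1) (*-identityʳ n))
    (sumTo-mono n λ i _ → h i)

  outer≤ : ∀ N → outer N ≤ quarterDisk N + 2 * N
  outer≤ N = begin
    outer N
      ≤⟨ sumTo-mono N (λ i _ → sumTo-step N (cell N i)) ⟩
    sumTo N (λ i → cell N i 0 + rest i)
      ≡⟨ sumTo-+ N (λ i → cell N i 0) rest ⟩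
    sumTo N (λ i → cell N i 0) + sumTo N rest
      ≤⟨ +-mono-≤ (sumTo≤ N _ λ i → cell≤1 N i 0) (sumTo-step N rest) ⟩
    N + (rest 0 + quarterDisk N)
      ≤⟨ +-monoʳ-≤ N (+-monoˡ-≤ (quarterDisk N) (sumTo≤ N _ λ j → cell≤1 N 0 (suc j))) ⟩
    N + (N + quarterDisk N)
      ≡⟨ solve 2 (λ N A → N :+ (N :+ A) := A :+ con 2 :* N) refl N (quarterDisk N) ⟩
    quarterDisk N + 2 * N ∎
    where
      open ≤-Reasoning
      rest : ℕ → ℕ
      rest i = sumTo N λ j → cell N i (suc j)

  cross : ∀ M N .{{_ : NonZero M}} →
    N * N * quarterDisk M ≤ M * M * (quarterDisk N + 2 * N)
  cross M N = ≤-trans (refine-lower M N)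
    (subst (λ K → quarterDisk K ≤ M * M * (quarterDisk N + 2 * N)) (*-comm N M)
      (≤-trans (refine-upper N M) (*-monoʳ-≤ (M * M) (outer≤ N))))

  cross′ : ∀ M N .{{_ : NonZero M}} →
    4 * quarterDisk M * (N * N * N) ≤
    (4 * quarterDisk N * N + 8 * (N * N)) * (M * M)
  cross′ M N = subst₂ _≤_
    (solve 2 (λ N A → con 4 :* N :* (N :* N :* A) := con 4 :* A :* (N :* N :* N))
      refl N (quarterDisk M))
    (solve 3 (λ N M A → con 4 :* N :* (M :* M :* (A :+ con 2 :* N)) :=
               (con 4 :* A :* N :+ con 8 :* (N :* N)) :* (M :* M))
      refl N M (quarterDisk N))
    (*-monoʳ-≤ (4 * N) (cross M N))

module ℚLemmas where
  open import Data.Rational.Base hiding (_/_; +-rawMonoid; *-rawMonoid)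
  open ℚP
  open ℚS.+-*-Solver

  half-pos : ∀ {ε} → 0ℚ < ε → 0ℚ < ½ * ε
  half-pos {ε} h = positive⁻¹ (½ * ε) {{pos*pos⇒pos ½ ε {{positive h}}}}

  half+half : ∀ ε → ½ * ε + ½ * ε ≡ ε
  half+half ε = trans (sym (*-distribʳ-+ ε ½ ½)) (*-identityˡ ε)

  *-pos : ∀ {p q} → 0ℚ < p → 0ℚ < q → 0ℚ < p * q
  *-pos {p} {q} hp hq =
    positive⁻¹ (p * q) {{pos*pos⇒pos p {{positive hp}} q {{positive hq}}}}

  *-mono : ∀ {a b c d} → 0ℚ ≤ a → 0ℚ ≤ d → a ≤ b → c ≤ d → a * c ≤ b * d
  *-mono {a} {b} {c} {d} 0≤a 0≤d a≤b c≤d = ≤-trans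
    (*-monoˡ-≤-nonNeg a {{nonNegative 0≤a}} c≤d)
    (*-monoʳ-≤-nonNeg d {{nonNegative 0≤d}} a≤b)

  inv : (p : ℚ) → 0ℚ < p → ℚ
  inv p h = (1/ p) {{>-nonZero h}}

  inv-pos : ∀ p h → 0ℚ < inv p h
  inv-pos p h = positive⁻¹ _ {{1/pos⇒pos p {{positive h}}}}

  *-inv : ∀ p h → p * inv p h ≡ 1ℚ
  *-inv p h = *-inverseʳ p {{>-nonZero h}}

  cancel : ∀ p h q → p * (q * inv p h) ≡ q
  cancel p h q = trans
    (solve 3 (λ p q i → p :* (q :* i) := q :* (p :* i)) refl p q (inv p h))
    (trans (cong (q *_) (*-inv p h)) (*-identityʳ q))

  inv-anti : ∀ {p q} hp hq → p ≤ q → inv q hq ≤ inv p hp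
  inv-anti {p} {q} hp hq p≤q = subst₂ _≤_
    (cancel p hp (inv q hq))
    (trans (solve 3 (λ q i j → q :* (i :* j) := q :* (j :* i)) refl
             q (inv q hq) (inv p hp))
           (cancel q hq (inv p hp)))
    (*-monoʳ-≤-nonNeg (inv q hq * inv p hp)
      {{nonNegative (<⇒≤ (*-pos (inv-pos q hq) (inv-pos p hp)))}} p≤q)

  ≤∣∣ : ∀ p → p ≤ ∣ p ∣
  ≤∣∣ p with ≤-total 0ℚ p
  ... | inj₁ h = ≤-reflexive (sym (0≤p⇒∣p∣≡p h))
  ... | inj₂ h = ≤-trans h (0≤∣p∣ p)

  ∣∣-sym : ∀ p q → ∣ p - q ∣ ≡ ∣ q - p ∣
  ∣∣-sym p q = trans
    (cong ∣_∣ (solve 2 (λ p q → p :- q := :- (q :- p)) refl p q))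
    (∣-p∣≡∣p∣ (q - p))

  sub-≤ : ∀ {a b e} → a ≤ b + e → a - b ≤ e
  sub-≤ {a} {b} {e} h = subst (a - b ≤_)
    (solve 2 (λ b e → (b :+ e) :- b := e) refl b e) (+-monoˡ-≤ (- b) h)

  ∣-∣-bound : ∀ {a b e} → a ≤ b + e → b ≤ a + e → ∣ a - b ∣ ≤ e
  ∣-∣-bound {a} {b} {e} h h′ with ∣p∣≡p∨∣p∣≡-p (a - b)
  ... | inj₁ eq = subst (_≤ e) (sym eq) (sub-≤ h)
  ... | inj₂ eq = subst (_≤ e)
    (trans (solve 2 (λ a b → b :- a := :- (a :- b)) refl a b) (sym eq))
    (sub-≤ h′)

  near : ∀ {a b e} → ∣ a - b ∣ ≤ e → a ≤ b + e
  near {a} {b} {e} h = subst (_≤ b + e)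
    (solve 2 (λ a b → b :+ (a :- b) := a) refl a b)
    (+-monoʳ-≤ b (≤-trans (≤∣∣ (a - b)) h))

  near′ : ∀ {a b e} → ∣ a - b ∣ ≤ e → b ≤ a + e
  near′ {a} {b} {e} h = near (subst (_≤ e) (∣∣-sym a b) h)

  ∣∣-near : ∀ {a b e} → ∣ b - a ∣ ≤ e → ∣ b ∣ ≤ ∣ a ∣ + e
  ∣∣-near {a} {b} {e} h = ≤-trans
    (subst (λ t → ∣ t ∣ ≤ ∣ a ∣ + ∣ b - a ∣)
      (solve 2 (λ a b → a :+ (b :- a) := b) refl a b)
      (∣p+q∣≤∣p∣+∣q∣ a (b - a)))
    (+-monoʳ-≤ ∣ a ∣ h)

  +-diff : ∀ {a b c d e} → ∣ a - b ∣ ≤ ½ * e → ∣ c - d ∣ ≤ ½ * e →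
           ∣ (a + c) - (b + d) ∣ ≤ e
  +-diff {a} {b} {c} {d} {e} h h′ = subst₂ _≤_
    (cong ∣_∣ (solve 4 (λ a b c d →
      (a :- b) :+ (c :- d) := (a :+ c) :- (b :+ d)) refl a b c d))
    (half+half e)
    (≤-trans (∣p+q∣≤∣p∣+∣q∣ (a - b) (c - d)) (+-mono-≤ h h′))

  neg-diff : ∀ {a b e} → ∣ a - b ∣ ≤ e → ∣ (- a) - (- b) ∣ ≤ e
  neg-diff {a} {b} {e} h = subst (_≤ e)
    (trans (∣∣-sym a b)
      (cong ∣_∣ (solve 2 (λ a b → b :- a := (:- a) :- (:- b)) refl a b))) h

  *-diff : ∀ {a b c d A D e} → 0ℚ ≤ e → ∣ a ∣ ≤ A → ∣ d ∣ ≤ D →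
           ∣ a - b ∣ ≤ e → ∣ c - d ∣ ≤ e →
           ∣ a * c - b * d ∣ ≤ (A + D) * e
  *-diff {a} {b} {c} {d} {A} {D} {e} 0≤e hA hD h h′ = subst₂ _≤_
    (cong ∣_∣ (solve 4 (λ a b c d →
      a :* (c :- d) :+ d :* (a :- b) := a :* c :- b :* d) refl a b c d))
    (sym (*-distribʳ-+ e A D))
    (≤-trans (∣p+q∣≤∣p∣+∣q∣ (a * (c - d)) (d * (a - b)))
      (+-mono-≤
        (subst (_≤ A * e) (sym (∣p*q∣≡∣p∣*∣q∣ a (c - d)))
          (*-mono (0≤∣p∣ a) 0≤e hA h′))
        (subst (_≤ D * e) (sym (∣p*q∣≡∣p∣*∣q∣ d (a - b)))
          (*-mono (0≤∣p∣ d) 0≤e hD h))))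

  inv-diff : ∀ {a b c e} ha hb hc → c ≤ a → c ≤ b →
             ∣ a - b ∣ ≤ e * (c * c) → ∣ inv a ha - inv b hb ∣ ≤ e
  inv-diff {a} {b} {c} {e} ha hb hc c≤a c≤b h = subst₂ _≤_
    (trans (cong (∣ a - b ∣ *_) (sym (0≤p⇒∣p∣≡p 0≤ij)))
      (trans (sym (∣p*q∣≡∣p∣*∣q∣ (a - b) (i * j)))
        (trans (cong ∣_∣ eq) (∣∣-sym j i))))
    (trans (solve 3 (λ e c k →
              (e :* (c :* c)) :* (k :* k) := c :* (c :* (e :* k) :* k))
              refl e c k)
      (trans (cancel c hc (c * (e * k))) (cancel c hc e)))
    (*-mono (0≤∣p∣ (a - b)) (<⇒≤ (*-pos (inv-pos c hc) (inv-pos c hc))) h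
      (*-mono (<⇒≤ (inv-pos a ha)) (<⇒≤ (inv-pos c hc))
        (inv-anti hc ha c≤a) (inv-anti hc hb c≤b)))
    where
      i j k : ℚ
      i = inv a ha
      j = inv b hb
      k = inv c hc
      0≤ij : 0ℚ ≤ i * j
      0≤ij = <⇒≤ (*-pos (inv-pos a ha) (inv-pos b hb))
      eq : (a - b) * (i * j) ≡ j - i
      eq = trans
        (solve 4 (λ a b i j → (a :- b) :* (i :* j) :=
            a :* (j :* i) :- b :* (i :* j)) refl a b i j)
        (cong₂ _-_ (cancel a ha j) (cancel b hb i))

------------------------------------------------------------------------
-- Real numbers: Cauchy sequences of rationals with a modulus of
-- convergence, considered up to _≈_.

IsCauchy : (ℕ → ℚ) → Set
IsCauchy s = ∀ ε → 0ℚ ℚ.< ε → ∃ λ N → ∀ m n → N ℕ.≤ m → N ℕ.≤ n →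
             ℚ.∣ s m ℚ.- s n ∣ ℚ.≤ ε

record ℝ : Set where
  constructor mkℝ
  field
    seq    : ℕ → ℚ
    cauchy : IsCauchy seq

open ℝ public

infix 4 _≈_ _≤_ _<_

_≈_ : Rel ℝ 0ℓ
x ≈ y = ∀ ε → 0ℚ ℚ.< ε → ∃ λ N → ∀ n → N ℕ.≤ n →
        ℚ.∣ seq x n ℚ.- seq y n ∣ ℚ.≤ ε

_≤_ : Rel ℝ 0ℓ
x ≤ y = ∀ ε → 0ℚ ℚ.< ε → ∃ λ N → ∀ n → N ℕ.≤ n → seq x n ℚ.≤ seq y n ℚ.+ ε

_<_ : Rel ℝ 0ℓ
x < y = ∃ λ ε → 0ℚ ℚ.< ε × ∃ λ N → ∀ n → N ℕ.≤ n → seq x n ℚ.+ ε ℚ.≤ seq y n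

≤l : ∀ {a b n} → a ℕ.⊔ b ℕ.≤ n → a ℕ.≤ n
≤l {a} {b} = ℕP.m⊔n≤o⇒m≤o a b

≤r : ∀ {a b n} → a ℕ.⊔ b ℕ.≤ n → b ℕ.≤ n
≤r {a} {b} = ℕP.m⊔n≤o⇒n≤o a b

bounded : ∀ x → ∃₂ λ B N → 0ℚ ℚ.< B × (∀ n → N ℕ.≤ n → ℚ.∣ seq x n ∣ ℚ.≤ B)
bounded x with cauchy x 1ℚ (ℚP.positive⁻¹ 1ℚ)
... | N , h = ℚ.∣ seq x N ∣ ℚ.+ 1ℚ , N ,
  ℚP.+-mono-≤-< (ℚP.0≤∣p∣ (seq x N)) (ℚP.positive⁻¹ 1ℚ) ,
  λ n N≤n → ℚLemmas.∣∣-near (h n N N≤n ℕP.≤-refl)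

-- The Cauchy proofs are opaque only to keep normal forms small.
opaque
  const-cauchy : ∀ q → IsCauchy (λ _ → q)
  const-cauchy q ε 0<ε = 0 , λ _ _ _ _ →
    subst (λ t → ℚ.∣ t ∣ ℚ.≤ ε) (sym (ℚP.+-inverseʳ q)) (ℚP.<⇒≤ 0<ε)

  +-cauchy : ∀ x y → IsCauchy (λ n → seq x n ℚ.+ seq y n)
  +-cauchy x y ε 0<ε =
    let (M , hx) = cauchy x (½ ℚ.* ε) (ℚLemmas.half-pos 0<ε)
        (N , hy) = cauchy y (½ ℚ.* ε) (ℚLemmas.half-pos 0<ε)
    in M ℕ.⊔ N , λ m n ≤m ≤n →
       ℚLemmas.+-diff {seq x m} {seq x n} {seq y m} {seq y n}
         (hx m n (≤l ≤m) (≤l ≤n)) (hy m n (≤r ≤m) (≤r ≤n))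

  neg-cauchy : ∀ x → IsCauchy (λ n → ℚ.- seq x n)
  neg-cauchy x ε 0<ε =
    let (N , h) = cauchy x ε 0<ε
    in N , λ m n ≤m ≤n → ℚLemmas.neg-diff {seq x m} {seq x n} (h m n ≤m ≤n)

  *-cauchy : ∀ x y → IsCauchy (λ n → seq x n ℚ.* seq y n)
  *-cauchy x y ε 0<ε =
    let (A , K , 0<A , hA) = bounded x
        (D , L , 0<D , hD) = bounded y
        0<A+D = ℚP.+-mono-< 0<A 0<D
        δ = ε ℚ.* ℚLemmas.inv (A ℚ.+ D) 0<A+D
        0<δ = ℚLemmas.*-pos 0<ε (ℚLemmas.inv-pos (A ℚ.+ D) 0<A+D)
        (M , hx) = cauchy x δ 0<δ
        (N , hy) = cauchy y δ 0<δ
    in (K ℕ.⊔ L) ℕ.⊔ (M ℕ.⊔ N) , λ m n ≤m ≤n →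
       subst (ℚ.∣ _ ∣ ℚ.≤_) (ℚLemmas.cancel (A ℚ.+ D) 0<A+D ε)
         (ℚLemmas.*-diff (ℚP.<⇒≤ 0<δ)
           (hA m (≤l {K} (≤l ≤m))) (hD n (≤r {K} (≤l ≤n)))
           (hx m n (≤l {M} (≤r {K ℕ.⊔ L} ≤m)) (≤l {M} (≤r {K ℕ.⊔ L} ≤n)))
           (hy m n (≤r {M} (≤r {K ℕ.⊔ L} ≤m)) (≤r {M} (≤r {K ℕ.⊔ L} ≤n))))

⊔-pos : ∀ {δ} → 0ℚ ℚ.< δ → ∀ q → 0ℚ ℚ.< q ℚ.⊔ δ
⊔-pos {δ} 0<δ q = ℚP.<-≤-trans 0<δ (ℚP.p≤q⊔p q δ)

opaque
  recip-cauchy : ∀ x {δ} (0<δ : 0ℚ ℚ.< δ) →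
    IsCauchy (λ n → ℚLemmas.inv (seq x n ℚ.⊔ δ) (⊔-pos 0<δ (seq x n)))
  recip-cauchy x {δ} 0<δ ε 0<ε =
    let 0<εδδ = ℚLemmas.*-pos 0<ε (ℚLemmas.*-pos 0<δ 0<δ)
        (N , h) = cauchy x (ε ℚ.* (δ ℚ.* δ)) 0<εδδ
    in N , λ m n ≤m ≤n →
       ℚLemmas.inv-diff (⊔-pos 0<δ (seq x m)) (⊔-pos 0<δ (seq x n)) 0<δ
         (ℚP.p≤q⊔p (seq x m) δ) (ℚP.p≤q⊔p (seq x n) δ)
         (ℚLemmas.∣-∣-bound
           (max {seq x m} {seq x n} (ℚP.<⇒≤ 0<εδδ)
             (ℚLemmas.near {seq x m} {seq x n} (h m n ≤m ≤n)))
           (max {seq x n} {seq x m} (ℚP.<⇒≤ 0<εδδ)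
             (ℚLemmas.near′ {seq x m} {seq x n} (h m n ≤m ≤n))))
    where
      max : ∀ {a b e} → 0ℚ ℚ.≤ e → a ℚ.≤ b ℚ.+ e → a ℚ.⊔ δ ℚ.≤ (b ℚ.⊔ δ) ℚ.+ e
      max {a} {b} {e} 0≤e h = ℚP.⊔-lub
        (ℚP.≤-trans h (ℚP.+-monoˡ-≤ e (ℚP.p≤p⊔q b δ)))
        (ℚP.≤-trans (ℚP.≤-reflexive (sym (ℚP.+-identityʳ δ)))
          (ℚP.+-mono-≤ (ℚP.p≤q⊔p b δ) 0≤e))

fromℚ : ℚ → ℝ
fromℚ q = mkℝ (λ _ → q) (const-cauchy q)

fromℕ : ℕ → ℝ
fromℕ n = fromℚ (+ n / 1)

0ℝ 1ℝ : ℝ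
0ℝ = fromℚ 0ℚ
1ℝ = fromℚ 1ℚ

infix  8 -_
infixl 7 _*_
infixl 6 _+_ _-_

_+_ : ℝ → ℝ → ℝ
x + y = mkℝ (λ n → seq x n ℚ.+ seq y n) (+-cauchy x y)

-_ : ℝ → ℝ
- x = mkℝ (λ n → ℚ.- seq x n) (neg-cauchy x)

_-_ : ℝ → ℝ → ℝ
x - y = x + - y

_*_ : ℝ → ℝ → ℝ
x * y = mkℝ (λ n → seq x n ℚ.* seq y n) (*-cauchy x y)

-- The n-th term is 1 / max (xₙ, δ), where δ > 0 is the rational lower bound
-- for almost all xₙ contained in the proof of 0 < x; thus it is 1 / xₙ for
-- almost all n.
recip : (x : ℝ) → 0ℝ < x → ℝ
recip x (δ , 0<δ , _) =
  mkℝ (λ n → ℚLemmas.inv (seq x n ℚ.⊔ δ) (⊔-pos 0<δ (seq x n))) (recip-cauchy x 0<δ)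

*-pos : ∀ x y → 0ℝ < x → 0ℝ < y → 0ℝ < x * y
*-pos x y (δ , 0<δ , M , hx) (ε , 0<ε , N , hy) =
  δ ℚ.* ε , ℚLemmas.*-pos 0<δ 0<ε , M ℕ.⊔ N , λ n ≤n →
  subst (ℚ._≤ _) (sym (ℚP.+-identityˡ (δ ℚ.* ε)))
    (ℚLemmas.*-mono (ℚP.<⇒≤ 0<δ)
      (ℚP.≤-trans (ℚP.<⇒≤ 0<ε) (drop ε (hy n (≤r ≤n))))
      (drop δ (hx n (≤l ≤n))) (drop ε (hy n (≤r ≤n))))
  where
    drop : ∀ p {q} → 0ℚ ℚ.+ p ℚ.≤ q → p ℚ.≤ q
    drop p = subst (ℚ._≤ _) (ℚP.+-identityˡ p)

fromℕ-pos : ∀ n .{{_ : NonZero n}} → 0ℝ < fromℕ n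
fromℕ-pos n = + n / 1 , ℚP.positive⁻¹ _ {{ℚP.normalize-pos n 1}} , 0 ,
  λ _ _ → ℚP.≤-reflexive (ℚP.+-identityˡ _)

------------------------------------------------------------------------
-- π, the area of the unit disk, as the limit of 4 · quarterDisk N / N².

/-≤ : ∀ a b c k l m →
  a ℕ.* (suc l ℕ.* suc m) ℕ.≤ (b ℕ.* suc m ℕ.+ c ℕ.* suc l) ℕ.* suc k →
  + a / suc k ℚ.≤ + b / suc l ℚ.+ + c / suc m
/-≤ a b c k l m h = ℚP.toℚᵘ-cancel-≤ (begin
  ℚ.toℚᵘ (+ a / suc k)
    ≃⟨ ℚP.toℚᵘ-fromℚᵘ A ⟩
  A
    ≤⟨ ℚᵘ.*≤* (subst₂ ℤ._≤_ (ℤP.pos-* a _) eq (ℤ.+≤+ h)) ⟩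
  B ℚᵘ.+ C
    ≃⟨ ℚᵘP.≃-sym (ℚᵘP.+-cong (ℚP.toℚᵘ-fromℚᵘ B) (ℚP.toℚᵘ-fromℚᵘ C)) ⟩
  ℚ.toℚᵘ (+ b / suc l) ℚᵘ.+ ℚ.toℚᵘ (+ c / suc m)
    ≃⟨ ℚᵘP.≃-sym (ℚP.toℚᵘ-homo-+ (+ b / suc l) (+ c / suc m)) ⟩
  ℚ.toℚᵘ (+ b / suc l ℚ.+ + c / suc m) ∎)
  where
    open ℚᵘP.≤-Reasoning
    A B C : ℚᵘ.ℚᵘ
    A = ℚᵘ.mkℚᵘ (+ a) k
    B = ℚᵘ.mkℚᵘ (+ b) l
    C = ℚᵘ.mkℚᵘ (+ c) m
    eq : + ((b ℕ.* suc m ℕ.+ c ℕ.* suc l) ℕ.* suc k) ≡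
         (+ b ℤ.* + suc m ℤ.+ + c ℤ.* + suc l) ℤ.* + suc k
    eq = trans (ℤP.pos-* (b ℕ.* suc m ℕ.+ c ℕ.* suc l) (suc k)) (cong (ℤ._* + suc k)
      (trans (ℤP.pos-+ (b ℕ.* suc m) _) (cong₂ ℤ._+_ (ℤP.pos-* b _) (ℤP.pos-* c _))))

πseq : ℕ → ℚ
πseq n = + (4 ℕ.* quarterDisk N) / (N ℕ.* N)
  where
    N : ℕ
    N = suc n

πseq-near : ∀ m n → πseq m ℚ.≤ πseq n ℚ.+ + 8 / suc n
πseq-near m n = /-≤ (4 ℕ.* quarterDisk (suc m)) (4 ℕ.* quarterDisk (suc n)) 8
  (ℕ.pred (suc m ℕ.* suc m)) (ℕ.pred (suc n ℕ.* suc n)) n (DiskCount.cross′ (suc m) (suc n))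

8/-anti : ∀ {m n} → m ℕ.≤ n → + 8 / suc n ℚ.≤ + 8 / suc m
8/-anti {m} {n} m≤n = ℚP.≤-trans
  (/-≤ 8 0 8 n 0 m (subst₂ ℕ._≤_ (cong (ℕ._*_ 8) (sym (ℕP.*-identityˡ (suc m)))) refl
    (ℕP.*-monoʳ-≤ 8 (s≤s m≤n))))
  (ℚP.≤-reflexive (ℚP.+-identityˡ _))

archimedean : ∀ ε → 0ℚ ℚ.< ε → ∃ λ N → + 8 / suc N ℚ.≤ ε
archimedean ε@(ℚ.mkℚ (+ suc p) d _) _ = ℕ.pred (8 ℕ.* suc d) , ℚP.≤-trans
  (/-≤ 8 0 (suc p) (ℕ.pred (8 ℕ.* suc d)) 0 d
    (subst (ℕ._≤ (suc p ℕ.* 1) ℕ.* (8 ℕ.* suc d)) eq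
      (ℕP.*-monoˡ-≤ (8 ℕ.* suc d) {1} {suc p ℕ.* 1} (s≤s z≤n))))
  (ℚP.≤-reflexive (trans (ℚP.+-identityˡ _) (ℚP.↥p/↧p≡p ε)))
  where
    eq : 1 ℕ.* (8 ℕ.* suc d) ≡ 8 ℕ.* (1 ℕ.* suc d)
    eq = trans (ℕP.*-identityˡ (8 ℕ.* suc d))
      (cong (ℕ._*_ 8) (sym (ℕP.*-identityˡ (suc d))))
archimedean (ℚ.mkℚ (+ 0) d _) (ℚ.*<* (ℤ.+<+ ()))
archimedean (ℚ.mkℚ ℤ.-[1+ p ] d _) (ℚ.*<* ())

opaque
  π-cauchy : IsCauchy πseq
  π-cauchy ε 0<ε =
    let (N , h) = archimedean ε 0<ε
    in N , λ m n N≤m N≤n → ℚLemmas.∣-∣-bound {πseq m} {πseq n}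
      (ℚP.≤-trans (πseq-near m n) (ℚP.+-monoʳ-≤ (πseq n) (ℚP.≤-trans (8/-anti N≤n) h)))
      (ℚP.≤-trans (πseq-near n m) (ℚP.+-monoʳ-≤ (πseq m) (ℚP.≤-trans (8/-anti N≤m) h)))

π : ℝ
π = mkℝ πseq π-cauchy

π-pos : 0ℝ < π
π-pos = ½ , ℚP.positive⁻¹ ½ , 15 , λ n 15≤n →
  subst (½ ℚ.≤_) (shift (πseq n))
    (ℚP.+-monoˡ-≤ (ℚ.- ½)
      (ℚP.≤-trans (πseq-near 1 n) (ℚP.+-monoʳ-≤ (πseq n) (8/-anti 15≤n))))
  where
    shift : ∀ q → (q ℚ.+ ½) ℚ.- ½ ≡ q
    shift q = trans (ℚP.+-assoc q ½ (ℚ.- ½)) (ℚP.+-identityʳ q)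

π*ℕ-pos : ∀ n .{{_ : NonZero n}} → 0ℝ < π * fromℕ n
π*ℕ-pos n = *-pos π (fromℕ n) π-pos (fromℕ-pos n)

2*ℕ²-pos : ∀ n .{{_ : NonZero n}} → 0ℝ < fromℕ (2 ℕ.* n ℕ.^ 2)
2*ℕ²-pos n = fromℕ-pos _ {{ℕP.m*n≢0 2 (n ℕ.^ 2) {{_}} {{ℕP.m^n≢0 n 2}}}}

------------------------------------------------------------------------
-- Real polynomials in the indeterminates X 0, …, X (n - 1), as formal sums
-- of terms; monomials are exponent vectors, and like terms need not be
-- collected.

Monomial : ℕ → Set
Monomial = Vec ℕ

Poly : ℕ → Set
Poly n = List (ℝ × Monomial n)

coeff : ∀ {n} → Poly n → Monomial n → ℝ
coeff p α = foldr (λ (c , β) s → if does (VecP.≡-dec ℕP._≟_ β α) then c + s else s) 0ℝ p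

infix 4 _≈ₚ_

_≈ₚ_ : ∀ {n} → Rel (Poly n) 0ℓ
p ≈ₚ q = ∀ α → coeff p α ≈ coeff q α

infixl 8 _·ₚ_
infixl 7 _*ₚ_
infixl 6 _+ₚ_ _-ₚ_

_+ₚ_ : ∀ {n} → Poly n → Poly n → Poly n
_+ₚ_ = _++_

_*ₚ_ : ∀ {n} → Poly n → Poly n → Poly n
_*ₚ_ = cartesianProductWith λ (c , α) (d , β) → c * d , zipWith ℕ._+_ α β

_·ₚ_ : ∀ {n} → ℝ → Poly n → Poly n
a ·ₚ p = map (λ (c , α) → a * c , α) p

_-ₚ_ : ∀ {n} → Poly n → Poly n → Poly n
p -ₚ q = p +ₚ (- 1ℝ) ·ₚ q

const : ∀ {n} → ℝ → Poly n
const c = (c , replicate _ 0) ∷ []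

X : ∀ {n} → Fin n → Poly n
X i = (1ℝ , replicate _ 0 [ i ]≔ 1) ∷ []

sumₚ : ∀ {n} → List (Poly n) → Poly n
sumₚ = foldr _+ₚ_ []

DependsOnlyOn : ∀ {n} → Subset n → Poly n → Set
DependsOnlyOn S p = ∀ α i → i ∉ S → lookup α i ≢ 0 → coeff p α ≈ 0ℝ

DependsOnAtMost : ∀ {n} → ℕ → Poly n → Set
DependsOnAtMost R p = ∃ λ S → card S ℕ.≤ R × DependsOnlyOn S p

------------------------------------------------------------------------
-- The R-round Sherali–Adams proof system: R ⊢ p ≥0 says that the line
-- p ≥ 0 is derivable. An axiom p ≤ 0 is the line - p ≥ 0, and respect
-- identifies lines whose polynomials have the same coefficients.

infix 3 _⊢_≥0 _⊢_≤_

data _⊢_≥0 {n} (R : ℕ) : Poly n → Set where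
  square  : ∀ p → DependsOnAtMost R p → R ⊢ p *ₚ p ≥0
  bool≥   : ∀ u s → DependsOnAtMost R ((X u *ₚ X u -ₚ const 1ℝ) *ₚ s) →
            R ⊢ (X u *ₚ X u -ₚ const 1ℝ) *ₚ s ≥0
  bool≤   : ∀ u s → DependsOnAtMost R ((X u *ₚ X u -ₚ const 1ℝ) *ₚ s) →
            R ⊢ (- 1ℝ) ·ₚ ((X u *ₚ X u -ₚ const 1ℝ) *ₚ s) ≥0
  combine : (ls : List (ℝ × Poly n)) →
            All (λ (c , p) → 0ℝ ≤ c × (R ⊢ p ≥0)) ls →
            R ⊢ sumₚ (map (λ (c , p) → c ·ₚ p) ls) ≥0
  respect : ∀ {p q} → p ≈ₚ q → R ⊢ p ≥0 → R ⊢ q ≥0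

_⊢_≤_ : ∀ {n} → ℕ → Poly n → Poly n → Set
R ⊢ p ≤ q = R ⊢ q -ₚ p ≥0

------------------------------------------------------------------------
-- 2-XOR instances on a finite simple graph with vertex set Fin n.

record SimpleGraph (n : ℕ) : Set₁ where
  field
    Adj     : Rel (Fin n) 0ℓ
    adj?    : Decidable Adj
    adj-sym : Symmetric Adj
    irrefl  : ∀ i → ¬ Adj i i

open SimpleGraph public

-- Each edge is listed once, with its smaller endpoint first.
edges : ∀ {n} → SimpleGraph n → List (Fin n × Fin n)
edges {n} G = filter (λ (i , j) → (i <ᶠ? j) ×-dec adj? G i j)
                     (cartesianProduct (allFin n) (allFin n))

edgeCount : ∀ {n} → SimpleGraph n → ℕ
edgeCount G = length (edges G)

-- The values of sign at non-adjacent pairs are irrelevant.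
record EdgeSigns {n} (G : SimpleGraph n) : Set where
  field
    sign     : Fin n → Fin n → Sign
    sign-sym : ∀ {i j} → Adj G i j → sign i j ≡ sign j i

open EdgeSigns public

⟦_⟧ : Sign → ℝ
⟦ Sign.+ ⟧ = 1ℝ
⟦ Sign.- ⟧ = - 1ℝ

OBJ : ∀ {n} (G : SimpleGraph n) .{{_ : NonZero (edgeCount G)}} → EdgeSigns G → Poly n
OBJ {n} G b = fromℚ (+ 1 / edgeCount G) ·ₚ sumₚ (map satisfied (edges G))
  where
    satisfied : Fin n × Fin n → Poly n
    satisfied (i , j) = const (fromℚ ½) +ₚ (fromℚ ½ * ⟦ sign b i j ⟧) ·ₚ (X i *ₚ X j)

{-# OPTIONS --safe #-}

-- Match up the points of a set of 2m ≥ R points uniformly at random, let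
-- x_i x_j = b_ij on every matched pair {i , j} and let all signs be uniform
-- and independent otherwise. By exchangeability, the law of the signs on a
-- subset S does not depend on the points outside S, so this defines consistent
-- distributions on all sets of at most 2m vertices of an arbitrarily large
-- graph, and hence a pseudo-expectation that is nonnegative on every derivable
-- line. A constraint is satisfied with probability 1/2 + 1/(2(2m - 1)), which
-- is at least 1/2 + 1/(2R) for the least such m. So π ≥ 2 suffices.

module Submission where

import Algebra.Properties.Semiring.Sum as SemiringSum
open import Algebra.Bundles using (CommutativeRing)
open import Data.Bool.Base using (Bool; true; false; not; _xor_; if_then_else_)
import Data.Bool.Properties as BoolP
open import Data.Fin.Base using (Fin; zero; suc) renaming (_<_ to _<ᶠ_)
import Data.Fin.Properties as FinP
open import Data.Fin.Subset using (Subset; ∣_∣; _∉_)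
open import Data.Fin.Subset.Properties using (_∈?_)
import Data.Integer.Base as ℤ
import Data.Integer.Properties as ℤP
open import Data.List.Base as List
  using (List; []; _∷_; _++_; map; foldr; filter; length; cartesianProduct; allFin)
import Data.List.Properties as ListP
open import Data.List.Relation.Unary.All as All using (All; []; _∷_)
import Data.List.Relation.Unary.All.Properties as AllP
open import Data.Nat.Base as ℕ using (ℕ; zero; suc; z≤n; s≤s; NonZero)
import Data.Nat.Properties as ℕP
open import Data.Product.Base using (_×_; _,_; proj₁; proj₂; ∃)
open import Data.Rational.Base as ℚ using (ℚ; 0ℚ; 1ℚ; ½; _/_)
import Data.Rational.Properties as ℚP
import Data.Rational.Solver as ℚS
import Data.Rational.Unnormalised.Base as ℚᵘ
import Data.Rational.Unnormalised.Properties as ℚᵘP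
open import Data.Sign.Base as Sign using (Sign)
open import Data.Sum.Base using (_⊎_; inj₁; inj₂)
open import Data.Vec.Base as Vec using (Vec; []; _∷_; lookup; zipWith; replicate; _[_]≔_)
import Data.Vec.Properties as VecP
open import Function.Base using (_∘_)
open import Relation.Binary.PropositionalEquality
  using (_≡_; _≢_; refl; sym; trans; cong; cong₂; subst; subst₂; module ≡-Reasoning)
open import Relation.Nullary.Decidable.Core using (Dec; yes; no; does; ¬?; _→-dec_; _×-dec_)
open import Relation.Nullary.Negation.Core using (¬_; contradiction)
open import Relation.Unary using (Decidable)
open ℚS.+-*-Solver using (solve; con; _:=_; _:+_; _:*_; _:-_; :-_)

-- Moments of random matchings

-- On a complete graph with all signs -1 and more than 2m vertices, no assignment reaches 1/2 +
-- 1/(2(2m - 1)), so the functional is in general not the expectation of any law on all vertices.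
-- Two descriptions are therefore kept side by side. `haf` gives the moment of x_T by a formula that
-- mentions no S, and so defines one functional on all polynomials. `density` is a law attached to a
-- single S, and makes squares of polynomials in the indeterminates of S nonnegative. The link is
-- `moment≡haf`: in the recursion for the moments of `density`, the size of S cancels. The means
-- a_ij on matched pairs stay arbitrary with |a_ij| ≤ 1 until the signs of the instance are
-- inserted.

module Matching where
  open import Data.Rational.Base using (_+_; _*_; _-_; -_; _≤_; _<_; nonNegative)
  open import Defs using (module ℚLemmas)
  open ℚLemmas using (inv; inv-pos; *-inv)
  module Sum = SemiringSum (CommutativeRing.semiring ℚP.+-*-commutativeRing)

  0≤1 : 0ℚ ≤ 1ℚ
  0≤1 = ℚP.nonNegative⁻¹ 1ℚ

  0≤+ : ∀ {p q} → 0ℚ ≤ p → 0ℚ ≤ q → 0ℚ ≤ p + q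
  0≤+ = ℚP.+-mono-≤

  0≤* : ∀ {p q} → 0ℚ ≤ p → 0ℚ ≤ q → 0ℚ ≤ p * q
  0≤* {p} {q} hp hq = ℚP.nonNegative⁻¹ _
    {{ℚP.nonNeg*nonNeg⇒nonNeg p {{nonNegative hp}} q {{nonNegative hq}}}}

  -- Opaque, because unification gets stuck on the unfolded sum.
  opaque
    sum : ∀ {n} → (Fin n → ℚ) → ℚ
    sum = Sum.sum

    sum-[] : (f : Fin 0 → ℚ) → sum f ≡ 0ℚ
    sum-[] f = refl

    sum-∷ : ∀ {n} (f : Fin (suc n) → ℚ) → sum f ≡ f zero + sum (f ∘ suc)
    sum-∷ f = refl

    sum-cong : ∀ {n} {f g : Fin n → ℚ} → (∀ i → f i ≡ g i) → sum f ≡ sum g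
    sum-cong h = Sum.sum-cong-≗ h

    sum-+ : ∀ {n} (f g : Fin n → ℚ) → sum (λ i → f i + g i) ≡ sum f + sum g
    sum-+ = Sum.∑-distrib-+

    *-sum : ∀ {n} c (f : Fin n → ℚ) → c * sum f ≡ sum (λ i → c * f i)
    *-sum = Sum.*-distribˡ-sum

    sum-* : ∀ {n} c (f : Fin n → ℚ) → sum f * c ≡ sum (λ i → f i * c)
    sum-* = Sum.*-distribʳ-sum

    sum-zero : ∀ {n} (f : Fin n → ℚ) → (∀ i → f i ≡ 0ℚ) → sum f ≡ 0ℚ
    sum-zero {n} f h = trans (Sum.sum-cong-≗ h) (Sum.sum-replicate-zero n)

    0≤sum : ∀ {n} (f : Fin n → ℚ) → (∀ i → 0ℚ ≤ f i) → 0ℚ ≤ sum f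
    0≤sum {zero}  f h = ℚP.≤-refl
    0≤sum {suc n} f h = 0≤+ (h zero) (0≤sum (f ∘ suc) (h ∘ suc))

  -- The embedding of ℕ into ℚ, by recursion rather than as a fraction, so that `count (suc n)`
  -- unfolds to `1ℚ + count n` for the ring solver.
  count : ℕ → ℚ
  count zero    = 0ℚ
  count (suc n) = 1ℚ + count n

  0≤count : ∀ n → 0ℚ ≤ count n
  0≤count zero    = ℚP.≤-refl
  0≤count (suc n) = 0≤+ 0≤1 (0≤count n)

  0<count : ∀ n → 0ℚ < count (suc n)
  0<count n = ℚP.+-mono-<-≤ (ℚP.positive⁻¹ 1ℚ) (0≤count n)

  count-mono : ∀ {m n} → m ℕ.≤ n → count m ≤ count n
  count-mono {n = n} z≤n = 0≤count n
  count-mono (s≤s h) = ℚP.+-monoʳ-≤ 1ℚ (count-mono h)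

  𝟙 : Bool → ℚ
  𝟙 false = 0ℚ
  𝟙 true  = 1ℚ

  infix 4 _⊑_

  _⊑_ : ∀ {n} → Subset n → Subset n → Set
  T ⊑ S = ∀ i → lookup T i ≡ true → lookup S i ≡ true

  sum-𝟙 : ∀ {n} (S : Subset n) → sum (λ u → 𝟙 (lookup S u)) ≡ count ∣ S ∣
  sum-𝟙 []          = sum-[] _
  sum-𝟙 (false ∷ S) = trans (sum-∷ _) (trans (ℚP.+-identityˡ _) (sum-𝟙 S))
  sum-𝟙 (true ∷ S)  = trans (sum-∷ _) (cong (1ℚ +_) (sum-𝟙 S))

  card-remove : ∀ {n} (S : Subset n) u → lookup S u ≡ true → ∣ S ∣ ≡ suc ∣ S [ u ]≔ false ∣
  card-remove (true ∷ S)  zero    h = refl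
  card-remove (true ∷ S)  (suc u) h = cong suc (card-remove S u h)
  card-remove (false ∷ S) (suc u) h = card-remove S u h

  card-mono : ∀ {n} (T S : Subset n) → T ⊑ S → ∣ T ∣ ℕ.≤ ∣ S ∣
  card-mono []          []          h = z≤n
  card-mono (false ∷ T) (false ∷ S) h = card-mono T S (h ∘ suc)
  card-mono (false ∷ T) (true ∷ S)  h = ℕP.m≤n⇒m≤1+n (card-mono T S (h ∘ suc))
  card-mono (true ∷ T)  (true ∷ S)  h = s≤s (card-mono T S (h ∘ suc))
  card-mono (true ∷ T)  (false ∷ S) h = contradiction (h zero refl) λ ()

  empty : ∀ {n} (S : Subset n) → ∣ S ∣ ℕ.≤ 0 → ∀ u → lookup S u ≡ false
  empty S h u with lookup S u in eq
  ... | false = refl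
  ... | true  = contradiction (subst (ℕ._≤ 0) (card-remove S u eq) h) λ ()

  double : ℕ → ℕ
  double zero    = 0
  double (suc m) = suc (suc (double m))

  -- The number of possible partners of a point when `suc m` pairs are formed; the shifted index
  -- keeps it positive for every `m`.
  1+2× : ℕ → ℚ
  1+2× m = count (suc (double m))

  1/[1+2×_] : ℕ → ℚ
  1/[1+2× m ] = inv (1+2× m) (0<count (double m))

  1+2×-cancel : ∀ m p → 1+2× m * (1/[1+2× m ] * p) ≡ p
  1+2×-cancel m p = trans (sym (ℚP.*-assoc (1+2× m) _ p))
    (trans (cong (_* p) (*-inv (1+2× m) (0<count (double m)))) (ℚP.*-identityˡ p))

  Matrix : ℕ → Set
  Matrix n = Fin n → Fin n → ℚ

  minor : ∀ {n} → Matrix (suc n) → Matrix n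
  minor a i j = a (suc i) (suc j)

  -- The Hafnian of a restricted to T, divided by (2m - 1)(2m - 3)⋯(2m - |T| + 1):
  -- the moment of x_T when T is contained in a set of 2m points that is matched
  -- up uniformly at random and x_i x_j has mean a i j on every matched pair.
  -- Only the entries of a above the diagonal are used.
  haf : ∀ {n} → ℕ → Matrix n → Subset n → ℚ
  haf m       a []          = 1ℚ
  haf m       a (false ∷ T) = haf m (minor a) T
  haf zero    a (true ∷ T)  = 0ℚ
  haf (suc m) a (true ∷ T)  = 1/[1+2× m ] *
    sum λ u → 𝟙 (lookup T u) * (a zero (suc u) * haf m (minor a) (T [ u ]≔ false))

  -- From `m` to `suc m` the denominator of the Hafnian gains 2m + 1 and loses 2m + 1 - |T|. In
  -- terms of matchings of 2m + 2 points, fix a point outside T: if its partner is in T, the moment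
  -- of x_T is 0; otherwise, with probability (2m + 1 - |T|)/(2m + 1), T sits among the other 2m
  -- points. In product form the identity includes |T| = 2m + 1, where both sides vanish.
  haf-suc : ∀ {n} m (a : Matrix n) T → ∣ T ∣ ℕ.≤ suc (double m) →
    (1+2× m - count ∣ T ∣) * haf m a T ≡ 1+2× m * haf (suc m) a T
  haf-suc m a [] h = solve 1 (λ x → (x :- con 0ℚ) :* con 1ℚ := x :* con 1ℚ) refl (1+2× m)
  haf-suc m a (false ∷ T) h = haf-suc m (minor a) T h
  haf-suc zero a (true ∷ T) (s≤s h) = trans (ℚP.*-zeroʳ (1+2× 0 - count (suc ∣ T ∣))) (sym
    (trans (1+2×-cancel 0 _) (sum-zero _ λ u → trans
      (cong (λ b → 𝟙 b * f u) (empty T h u)) (ℚP.*-zeroˡ (f u)))))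
    where
      f : ∀ u → ℚ
      f u = a zero (suc u) * haf 0 (minor a) (T [ u ]≔ false)
  haf-suc (suc m) a (true ∷ T) (s≤s h) = trans (cong (k *_) (*-sum 1/[1+2× m ] _))
    (trans (*-sum k _) (trans (sum-cong term) (sym (1+2×-cancel (suc m) _))))
    where
      k : ℚ
      k = 1+2× (suc m) - count (suc ∣ T ∣)
      f g : ∀ u → ℚ
      f u = haf m (minor a) (T [ u ]≔ false)
      g u = haf (suc m) (minor a) (T [ u ]≔ false)
      term : ∀ u → k * (1/[1+2× m ] * (𝟙 (lookup T u) * (a zero (suc u) * f u))) ≡
                   𝟙 (lookup T u) * (a zero (suc u) * g u)
      term u with lookup T u in eq
      ... | false = solve 4 (λ k r x y → k :* (r :* (con 0ℚ :* x)) := con 0ℚ :* y) refl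
                      k 1/[1+2× m ] (a zero (suc u) * f u) (a zero (suc u) * g u)
      -- Removing the first vertex and `u` lowers the set by two, as passing from `suc m` to `m`
      -- lowers the number of partners, so `k` is the factor of the induction hypothesis.
      ... | true  = begin
        k * (1/[1+2× m ] * (1ℚ * (a zero (suc u) * f u)))
          ≡⟨ cong (λ c → (1+2× (suc m) - count (suc c)) * (1/[1+2× m ] * (1ℚ * (a zero (suc u) * f u))))
               (card-remove T u eq) ⟩
        (1+2× (suc m) - count (suc (suc c))) * (1/[1+2× m ] * (1ℚ * (a zero (suc u) * f u)))
          ≡⟨ solve 5 (λ o c r e f →
               (con 1ℚ :+ (con 1ℚ :+ o) :- (con 1ℚ :+ (con 1ℚ :+ c))) :* (r :* (con 1ℚ :* (e :* f))) :=
               e :* (r :* ((o :- c) :* f))) refl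
               (1+2× m) (count c) 1/[1+2× m ] (a zero (suc u)) (f u) ⟩
        a zero (suc u) * (1/[1+2× m ] * ((1+2× m - count c) * f u))
          ≡⟨ cong (λ t → a zero (suc u) * (1/[1+2× m ] * t)) (haf-suc m (minor a) (T [ u ]≔ false)
               (ℕP.≤-pred (subst (ℕ._≤ suc (suc (double m))) (card-remove T u eq) h))) ⟩
        a zero (suc u) * (1/[1+2× m ] * (1+2× m * g u))
          ≡⟨ solve 4 (λ o r e g → e :* (r :* (o :* g)) := con 1ℚ :* (e :* (o :* (r :* g)))) refl
               (1+2× m) 1/[1+2× m ] (a zero (suc u)) (g u) ⟩
        1ℚ * (a zero (suc u) * (1+2× m * (1/[1+2× m ] * g u)))
          ≡⟨ cong (λ t → 1ℚ * (a zero (suc u) * t)) (1+2×-cancel m (g u)) ⟩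
        1ℚ * (a zero (suc u) * g u) ∎
        where
          open ≡-Reasoning
          c : ℕ
          c = ∣ T [ u ]≔ false ∣

  -- Averages over uniform signs, and characters

  marginal : ∀ {n} → (Vec Sign (suc n) → ℚ) → Vec Sign n → ℚ
  marginal f x = ½ * (f (Sign.+ ∷ x) + f (Sign.- ∷ x))

  opaque
    avg : ∀ {n} → (Vec Sign n → ℚ) → ℚ
    avg {zero}  f = f []
    avg {suc n} f = avg (marginal f)

    avg-[] : (f : Vec Sign 0 → ℚ) → avg f ≡ f []
    avg-[] f = refl

    avg-∷ : ∀ {n} (f : Vec Sign (suc n) → ℚ) →
      avg f ≡ avg (marginal f)
    avg-∷ f = refl

    avg-cong : ∀ {n} {f g : Vec Sign n → ℚ} → (∀ x → f x ≡ g x) → avg f ≡ avg g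
    avg-cong {zero}  h = h []
    avg-cong {suc n} h = avg-cong λ x →
      cong (½ *_) (cong₂ _+_ (h (Sign.+ ∷ x)) (h (Sign.- ∷ x)))

    avg-+ : ∀ {n} (f g : Vec Sign n → ℚ) → avg (λ x → f x + g x) ≡ avg f + avg g
    avg-+ {zero}  f g = refl
    avg-+ {suc n} f g = trans
      (avg-cong λ x → solve 5 (λ h a b c d →
        h :* ((a :+ c) :+ (b :+ d)) := h :* (a :+ b) :+ h :* (c :+ d)) refl
        ½ (f (Sign.+ ∷ x)) (f (Sign.- ∷ x)) (g (Sign.+ ∷ x)) (g (Sign.- ∷ x)))
      (avg-+ (marginal f) (marginal g))

    avg-* : ∀ {n} c (f : Vec Sign n → ℚ) → avg (λ x → c * f x) ≡ c * avg f
    avg-* {zero}  c f = refl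
    avg-* {suc n} c f = trans
      (avg-cong λ x → solve 4 (λ h c a b →
        h :* (c :* a :+ c :* b) := c :* (h :* (a :+ b))) refl
        ½ c (f (Sign.+ ∷ x)) (f (Sign.- ∷ x)))
      (avg-* c (marginal f))

    avg-zero : ∀ {n} (f : Vec Sign n → ℚ) → (∀ x → f x ≡ 0ℚ) → avg f ≡ 0ℚ
    avg-zero {n} f h = trans (avg-cong {n} λ x → trans (h x) (sym (ℚP.*-zeroˡ 0ℚ)))
      (trans (avg-* {n} 0ℚ (λ _ → 0ℚ)) (ℚP.*-zeroˡ (avg {n} (λ _ → 0ℚ))))

    0≤avg : ∀ {n} (f : Vec Sign n → ℚ) → (∀ x → 0ℚ ≤ f x) → 0ℚ ≤ avg f
    0≤avg {zero}  f h = h []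
    0≤avg {suc n} f h = 0≤avg _ λ x →
      0≤* (ℚP.nonNegative⁻¹ ½) (0≤+ (h (Sign.+ ∷ x)) (h (Sign.- ∷ x)))

  avg-sum : ∀ {m n} (f : Fin m → Vec Sign n → ℚ) →
    avg (λ x → sum λ u → f u x) ≡ sum λ u → avg (f u)
  avg-sum {zero}  f = trans (avg-zero _ λ x → sum-[] _) (sym (sum-[] _))
  avg-sum {suc m} f = trans (avg-cong λ x → sum-∷ λ u → f u x)
    (trans (avg-+ (f zero) (λ x → sum λ u → f (suc u) x))
      (trans (cong (avg (f zero) +_) (avg-sum (f ∘ suc))) (sym (sum-∷ λ u → avg (f u)))))

  σ : Sign → ℚ
  σ Sign.+ = 1ℚ
  σ Sign.- = - 1ℚ

  -- The Walsh character x_T, that is, the multilinear monomial of T at a sign vector.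
  χ : ∀ {n} → Subset n → Vec Sign n → ℚ
  χ []          []      = 1ℚ
  χ (false ∷ T) (s ∷ x) = χ T x
  χ (true ∷ T)  (s ∷ x) = σ s * χ T x

  σ² : ∀ s → σ s * σ s ≡ 1ℚ
  σ² Sign.+ = refl
  σ² Sign.- = refl

  χ-toggle : ∀ {n} (T : Subset n) x u {t} → lookup T u ≡ t →
    σ (lookup x u) * χ T x ≡ χ (T [ u ]≔ not t) x
  χ-toggle (false ∷ T) (s ∷ x) zero refl = refl
  χ-toggle (true ∷ T)  (s ∷ x) zero refl = trans (sym (ℚP.*-assoc (σ s) (σ s) _))
    (trans (cong (_* χ T x) (σ² s)) (ℚP.*-identityˡ _))
  χ-toggle (false ∷ T) (s ∷ x) (suc u) h = χ-toggle T x u h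
  χ-toggle (true ∷ T)  (s ∷ x) (suc u) h = trans
    (solve 3 (λ a b c → a :* (b :* c) := b :* (a :* c)) refl (σ (lookup x u)) (σ s) (χ T x))
    (cong (σ s *_) (χ-toggle T x u h))

  χ-xor : ∀ {n} (T U : Subset n) x → χ (zipWith _xor_ T U) x ≡ χ T x * χ U x
  χ-xor []          []          []      = refl
  χ-xor (false ∷ T) (false ∷ U) (s ∷ x) = χ-xor T U x
  χ-xor (false ∷ T) (true ∷ U)  (s ∷ x) = trans (cong (σ s *_) (χ-xor T U x))
    (solve 3 (λ a b c → a :* (b :* c) := b :* (a :* c)) refl (σ s) (χ T x) (χ U x))
  χ-xor (true ∷ T)  (false ∷ U) (s ∷ x) = trans (cong (σ s *_) (χ-xor T U x))
    (sym (ℚP.*-assoc (σ s) (χ T x) (χ U x)))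
  χ-xor (true ∷ T)  (true ∷ U)  (s ∷ x) = trans (χ-xor T U x)
    (trans (sym (ℚP.*-identityˡ _)) (trans (cong (_* (χ T x * χ U x)) (sym (σ² s)))
      (solve 3 (λ a b c → (a :* a) :* (b :* c) := (a :* b) :* (a :* c)) refl
        (σ s) (χ T x) (χ U x))))

  -- The first vertex of S is matched with each of the other 2m + 1 points with
  -- the same probability; 2m + 1 - |S| of these lie outside S.
  density : ∀ {n} → ℕ → Matrix n → Subset n → Vec Sign n → ℚ
  density zero    a S           x       = 1ℚ
  density (suc m) a []          []      = 1ℚ
  density (suc m) a (false ∷ S) (s ∷ x) = density (suc m) (minor a) S x
  density (suc m) a (true ∷ S)  (s ∷ x) = 1/[1+2× m ] *
    (sum (λ u → 𝟙 (lookup S u) * ((1ℚ + a zero (suc u) * (σ s * σ (lookup x u))) *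
                                  density m (minor a) (S [ u ]≔ false) x)) +
     (1+2× m - count ∣ S ∣) * density m (minor a) S x)

  -- Relative to uniform signs, 1 + a_ij x_i x_j is the density of a matched pair whose product has
  -- mean a_ij. It is nonnegative exactly if |a_ij| ≤ 1.
  Bounded : ∀ {n} → Matrix n → Set
  Bounded a = ∀ i j s → 0ℚ ≤ 1ℚ + a i j * σ s

  0≤1/[1+2×] : ∀ m → 0ℚ ≤ 1/[1+2× m ]
  0≤1/[1+2×] m = ℚP.<⇒≤ (inv-pos (1+2× m) (0<count (double m)))

  σ-* : ∀ s t → σ s * σ t ≡ σ (s Sign.* t)
  σ-* Sign.+ Sign.+ = refl
  σ-* Sign.+ Sign.- = refl
  σ-* Sign.- Sign.+ = refl
  σ-* Sign.- Sign.- = refl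

  0≤difference : ∀ {p q} → p ≤ q → 0ℚ ≤ q - p
  0≤difference {p} {q} h = subst (_≤ q - p) (ℚP.+-inverseʳ p) (ℚP.+-monoˡ-≤ (- p) h)

  -- If all 2m + 1 partners of the first vertex lie in S, its partner cannot be
  -- outside S, and the factor 2m + 1 - |S| cancels the meaningless density m a S.
  0≤outside : ∀ m c d → c ℕ.≤ suc (double m) → (c ℕ.≤ double m → 0ℚ ≤ d) →
    0ℚ ≤ (1+2× m - count c) * d
  0≤outside m c d h h′ with ℕP.m≤n⇒m<n∨m≡n h
  ... | inj₁ (s≤s c≤) = 0≤* (0≤difference (count-mono h)) (h′ c≤)
  ... | inj₂ refl     = ℚP.≤-reflexive (sym (trans
    (cong (_* d) (ℚP.+-inverseʳ (1+2× m))) (ℚP.*-zeroˡ d)))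

  remove-≤ : ∀ {n} (S : Subset n) u {c} → lookup S u ≡ true → ∣ S ∣ ℕ.≤ suc c → ∣ S [ u ]≔ false ∣ ℕ.≤ c
  remove-≤ S u {c} eq h = ℕP.≤-pred (subst (ℕ._≤ suc c) (card-remove S u eq) h)

  0≤density : ∀ {n} m (a : Matrix n) S x → Bounded a → ∣ S ∣ ℕ.≤ double m → 0ℚ ≤ density m a S x
  0≤density zero    a S           x       b h = 0≤1
  0≤density (suc m) a []          []      b h = 0≤1
  0≤density (suc m) a (false ∷ S) (s ∷ x) b h =
    0≤density (suc m) (minor a) S x (λ i j → b (suc i) (suc j)) h
  0≤density (suc m) a (true ∷ S)  (s ∷ x) b (s≤s h) =
    0≤* (0≤1/[1+2×] m) (0≤+ (0≤sum _ term)
      (0≤outside m ∣ S ∣ _ h λ h′ → 0≤density m (minor a) S x (λ i j → b (suc i) (suc j)) h′))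
    where
      term : ∀ u → 0ℚ ≤ 𝟙 (lookup S u) * ((1ℚ + a zero (suc u) * (σ s * σ (lookup x u))) *
                                  density m (minor a) (S [ u ]≔ false) x)
      term u with lookup S u in eq
      ... | false = ℚP.≤-reflexive (sym (ℚP.*-zeroˡ
        ((1ℚ + a zero (suc u) * (σ s * σ (lookup x u))) * density m (minor a) (S [ u ]≔ false) x)))
      ... | true  = 0≤* 0≤1 (0≤*
        (subst (λ t → 0ℚ ≤ 1ℚ + a zero (suc u) * t) (sym (σ-* s (lookup x u)))
          (b zero (suc u) (s Sign.* lookup x u)))
        (0≤density m (minor a) (S [ u ]≔ false) x (λ i j → b (suc i) (suc j)) (remove-≤ S u eq h)))

  -- Moments of the law attached to a set

  moment : ∀ {n} → ℕ → Matrix n → Subset n → Subset n → ℚ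
  moment m a S T = avg λ x → density m a S x * χ T x

  module _ {n} (m : ℕ) (a : Matrix (suc n)) (S : Subset n) where

    private
      w : ℚ
      w = 1+2× m - count ∣ S ∣
      d : Fin n → Vec Sign n → ℚ
      d u x = density m (minor a) (S [ u ]≔ false) x
      A B P Q : Vec Sign n → ℚ
      A x = sum λ u → 𝟙 (lookup S u) * d u x
      B x = sum λ u → 𝟙 (lookup S u) * (a zero (suc u) * (σ (lookup x u) * d u x))
      P x = 1/[1+2× m ] * (A x + w * density m (minor a) S x)
      Q x = 1/[1+2× m ] * B x

      -- The density is affine in the first sign. Averaging it over that sign leaves `P`, and
      -- averaging it times that sign leaves `Q`; this gives the two recursions below.
      density-true : ∀ s x → density (suc m) a (true ∷ S) (s ∷ x) ≡ P x + σ s * Q x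
      density-true s x = begin
        1/[1+2× m ] * (sum (λ u → 𝟙 (lookup S u) *
          ((1ℚ + a zero (suc u) * (σ s * σ (lookup x u))) * d u x)) + W)
          ≡⟨ cong (λ t → 1/[1+2× m ] * (t + W)) (trans
               (sum-cong λ u → solve 5 (λ i a s v d →
                  i :* ((con 1ℚ :+ a :* (s :* v)) :* d) := i :* d :+ s :* (i :* (a :* (v :* d)))) refl
                  (𝟙 (lookup S u)) (a zero (suc u)) (σ s) (σ (lookup x u)) (d u x))
               (trans (sum-+ _ _) (cong (A x +_) (sym (*-sum (σ s) _))))) ⟩
        1/[1+2× m ] * (A x + σ s * B x + W)
          ≡⟨ solve 5 (λ r A s B W → r :* (A :+ s :* B :+ W) := r :* (A :+ W) :+ s :* (r :* B)) refl
               1/[1+2× m ] (A x) (σ s) (B x) W ⟩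
        P x + σ s * Q x ∎
        where
          open ≡-Reasoning
          W : ℚ
          W = w * density m (minor a) S x

    moment-true-false : ∀ T → moment (suc m) a (true ∷ S) (false ∷ T) ≡
      1/[1+2× m ] * (sum (λ u → 𝟙 (lookup S u) * moment m (minor a) (S [ u ]≔ false) T) +
                     w * moment m (minor a) S T)
    moment-true-false T = begin
      moment (suc m) a (true ∷ S) (false ∷ T)
        ≡⟨ avg-∷ _ ⟩
      avg (λ x → ½ * (density (suc m) a (true ∷ S) (Sign.+ ∷ x) * χ T x +
                      density (suc m) a (true ∷ S) (Sign.- ∷ x) * χ T x))
        ≡⟨ avg-cong (λ x → trans
             (cong₂ (λ p q → ½ * (p * χ T x + q * χ T x))
               (density-true Sign.+ x) (density-true Sign.- x))
             (trans (solve 3 (λ p q c →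
                    con ½ :* ((p :+ con 1ℚ :* q) :* c :+ (p :+ con (- 1ℚ) :* q) :* c) := p :* c)
                 refl (P x) (Q x) (χ T x))
               (trans (solve 5 (λ r A w D c →
                    (r :* (A :+ w :* D)) :* c := r :* (A :* c :+ w :* (D :* c))) refl
                   1/[1+2× m ] (A x) w (density m (minor a) S x) (χ T x))
                 (cong (λ t → 1/[1+2× m ] * (t + w * (density m (minor a) S x * χ T x)))
                   (trans (sum-* (χ T x) (λ u → 𝟙 (lookup S u) * d u x))
                      (sum-cong λ u → ℚP.*-assoc (𝟙 (lookup S u)) (d u x) (χ T x))))))) ⟩
      avg (λ x → 1/[1+2× m ] * (sum (λ u → 𝟙 (lookup S u) * (d u x * χ T x)) +
                                w * (density m (minor a) S x * χ T x)))
        ≡⟨ trans (avg-* 1/[1+2× m ] _) (cong (1/[1+2× m ] *_) (trans (avg-+ _ _) (cong₂ _+_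
             (trans (avg-sum _) (sum-cong λ u → avg-* (𝟙 (lookup S u)) (λ x → d u x * χ T x)))
               (avg-* w (λ x → density m (minor a) S x * χ T x))))) ⟩
      1/[1+2× m ] * (sum (λ u → 𝟙 (lookup S u) * moment m (minor a) (S [ u ]≔ false) T) +
                     w * moment m (minor a) S T) ∎
      where open ≡-Reasoning

    -- A partner outside S leaves the first sign uniform and contributes nothing. A partner `u` in S
    -- replaces the first sign by `a zero (suc u)` times x_u, and since x_u² = 1 this toggles `u` in
    -- T.
    moment-true-true : ∀ T → moment (suc m) a (true ∷ S) (true ∷ T) ≡
      1/[1+2× m ] * sum λ u → 𝟙 (lookup S u) *
        (a zero (suc u) * moment m (minor a) (S [ u ]≔ false) (T [ u ]≔ not (lookup T u)))
    moment-true-true T = begin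
      moment (suc m) a (true ∷ S) (true ∷ T)
        ≡⟨ avg-∷ _ ⟩
      avg (λ x → ½ * (density (suc m) a (true ∷ S) (Sign.+ ∷ x) * (1ℚ * χ T x) +
                      density (suc m) a (true ∷ S) (Sign.- ∷ x) * (- 1ℚ * χ T x)))
        ≡⟨ avg-cong (λ x → trans
             (cong₂ (λ p q → ½ * (p * (1ℚ * χ T x) + q * (- 1ℚ * χ T x)))
               (density-true Sign.+ x) (density-true Sign.- x))
             (trans (solve 3 (λ p q c → con ½ :* ((p :+ con 1ℚ :* q) :* (con 1ℚ :* c) :+
                         (p :+ con (- 1ℚ) :* q) :* (con (- 1ℚ) :* c)) := q :* c)
                 refl (P x) (Q x) (χ T x))
               (trans (ℚP.*-assoc 1/[1+2× m ] (B x) (χ T x)) (cong (1/[1+2× m ] *_)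
                 (trans (sum-* (χ T x) (λ u → 𝟙 (lookup S u) * (a zero (suc u) * (σ (lookup x u) * d u x))))
                    (sum-cong λ u → trans
                   (solve 5 (λ i a v d c →
                      (i :* (a :* (v :* d))) :* c := i :* (a :* (d :* (v :* c)))) refl
                     (𝟙 (lookup S u)) (a zero (suc u)) (σ (lookup x u)) (d u x) (χ T x))
                   (cong (λ t → 𝟙 (lookup S u) * (a zero (suc u) * (d u x * t)))
                      (χ-toggle T x u refl)))))))) ⟩
      avg (λ x → 1/[1+2× m ] * sum λ u → 𝟙 (lookup S u) *
            (a zero (suc u) * (d u x * χ (T [ u ]≔ not (lookup T u)) x)))
        ≡⟨ trans (avg-* 1/[1+2× m ] _) (cong (1/[1+2× m ] *_) (trans (avg-sum _) (sum-cong λ u →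
             trans (avg-* (𝟙 (lookup S u))
                    (λ x → a zero (suc u) * (d u x * χ (T [ u ]≔ not (lookup T u)) x)))
               (cong (𝟙 (lookup S u) *_) (avg-* (a zero (suc u))
                    (λ x → d u x * χ (T [ u ]≔ not (lookup T u)) x)))))) ⟩
      (1/[1+2× m ] * sum λ u → 𝟙 (lookup S u) *
        (a zero (suc u) * moment m (minor a) (S [ u ]≔ false) (T [ u ]≔ not (lookup T u)))) ∎
      where open ≡-Reasoning

  1+2×-cancel′ : ∀ m p → 1/[1+2× m ] * (1+2× m * p) ≡ p
  1+2×-cancel′ m p = trans
    (solve 3 (λ o r p → r :* (o :* p) := o :* (r :* p)) refl (1+2× m) 1/[1+2× m ] p)
    (1+2×-cancel m p)

  density-[] : ∀ m a → density m a [] [] ≡ 1ℚ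
  density-[] zero    a = refl
  density-[] (suc m) a = refl

  -- `skip` covers both situations in which the first sign does not enter the density: its vertex
  -- lies outside the set, or `m` is 0.
  module _ {n} (m : ℕ) (a : Matrix (suc n)) (b : Bool) (S : Subset n)
           (skip : ∀ s x → density m a (b ∷ S) (s ∷ x) ≡ density m (minor a) S x) where

    moment-skip-false : ∀ T → moment m a (b ∷ S) (false ∷ T) ≡ moment m (minor a) S T
    moment-skip-false T = trans (avg-∷ _) (avg-cong λ x → trans
      (cong₂ (λ p q → ½ * (p * χ T x + q * χ T x)) (skip Sign.+ x) (skip Sign.- x))
      (solve 1 (λ p → con ½ :* (p :+ p) := p) refl (density m (minor a) S x * χ T x)))

    moment-skip-true : ∀ T → moment m a (b ∷ S) (true ∷ T) ≡ 0ℚ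
    moment-skip-true T = trans (avg-∷ _) (avg-zero _ λ x → trans
      (cong₂ (λ p q → ½ * (p * (1ℚ * χ T x) + q * (- 1ℚ * χ T x))) (skip Sign.+ x) (skip Sign.- x))
      (solve 2 (λ d c → con ½ :* (d :* (con 1ℚ :* c) :+ d :* (con (- 1ℚ) :* c)) := con 0ℚ) refl
        (density m (minor a) S x) (χ T x)))

  lookup-remove : ∀ {n} (S : Subset n) u i → lookup S i ≡ false → lookup (S [ u ]≔ false) i ≡ false
  lookup-remove S u i h with u FinP.≟ i
  ... | yes refl = VecP.lookup∘update u S false
  ... | no  u≢i  = trans (VecP.lookup∘update′ (u≢i ∘ sym) S false) h

  𝟙-false : ∀ {b} p → b ≡ false → 𝟙 b * p ≡ 0ℚ
  𝟙-false p refl = ℚP.*-zeroˡ p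

  𝟙-* : ∀ b {p} → (b ≡ true → p ≡ 0ℚ) → 𝟙 b * p ≡ 0ℚ
  𝟙-* false {p} h = ℚP.*-zeroˡ p
  𝟙-* true  {p} h = trans (ℚP.*-identityˡ p) (h refl)

  -- The density on S does not involve the sign at `u`, so that sign is uniform and independent of
  -- the others and x_u averages to 0.
  moment-outside : ∀ {n} m (a : Matrix n) S T u → lookup S u ≡ false → lookup T u ≡ true →
    moment m a S T ≡ 0ℚ
  moment-outside zero a (s ∷ S) (true ∷ T) u p q =
    moment-skip-true zero a s S (λ _ _ → refl) T
  moment-outside zero a (s ∷ S) (false ∷ T) (suc u) p q =
    trans (moment-skip-false zero a s S (λ _ _ → refl) T) (moment-outside zero (minor a) S T u p q)
  moment-outside (suc m) a (false ∷ S) (true ∷ T) u p q =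
    moment-skip-true (suc m) a false S (λ _ _ → refl) T
  moment-outside (suc m) a (false ∷ S) (false ∷ T) (suc u) p q =
    trans (moment-skip-false (suc m) a false S (λ _ _ → refl) T)
      (moment-outside (suc m) (minor a) S T u p q)
  moment-outside (suc m) a (true ∷ S) (false ∷ T) (suc u) p q =
    trans (moment-true-false m a S T) (trans
      (cong₂ (λ t t′ → 1/[1+2× m ] * (t + (1+2× m - count ∣ S ∣) * t′))
        (sum-zero _ λ v → 𝟙-* (lookup S v) λ _ →
          moment-outside m (minor a) (S [ v ]≔ false) T u (lookup-remove S v u p) q)
        (moment-outside m (minor a) S T u p q))
      (solve 2 (λ r w → r :* (con 0ℚ :+ w :* con 0ℚ) := con 0ℚ) refl
        1/[1+2× m ] (1+2× m - count ∣ S ∣)))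
  moment-outside (suc m) a (true ∷ S) (true ∷ T) (suc u) p q =
    trans (moment-true-true m a S T) (trans
      (cong (1/[1+2× m ] *_) (sum-zero _ λ v → 𝟙-* (lookup S v) λ Sv → trans
        (cong (a zero (suc v) *_)
          (moment-outside m (minor a) (S [ v ]≔ false) (T [ v ]≔ not (lookup T v)) u
            (lookup-remove S v u p)
            -- `v` is in S and `u` is not, so toggling `v` leaves `u` in the set.
            (trans (VecP.lookup∘update′ (λ { refl → contradiction (trans (sym p) Sv) λ () }) T _) q)))
        (ℚP.*-zeroʳ (a zero (suc v)))))
      (ℚP.*-zeroʳ 1/[1+2× m ]))

  ⊑-remove : ∀ {n} (T S : Subset n) u → T ⊑ S → lookup T u ≡ false → T ⊑ S [ u ]≔ false
  ⊑-remove T S u h p i q = trans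
    (VecP.lookup∘update′ (λ { refl → contradiction (trans (sym p) q) λ () }) S false) (h i q)

  remove-⊑ : ∀ {n} (T : Subset n) u → T [ u ]≔ false ⊑ T
  remove-⊑ T u i q with lookup T i in eq
  ... | true  = refl
  ... | false = trans (sym (lookup-remove T u i eq)) q

  -- The consistency of the local laws: the right side is free of S, so every S containing T assigns
  -- the same moment to x_T.
  moment≡haf : ∀ {n} m (a : Matrix n) S T → T ⊑ S → ∣ S ∣ ℕ.≤ double m → moment m a S T ≡ haf m a T
  moment≡haf m a [] [] h c = trans (avg-[] _) (cong (_* 1ℚ) (density-[] m a))
  moment≡haf zero a (s ∷ S) (true ∷ T) h c = moment-skip-true zero a s S (λ _ _ → refl) T
  moment≡haf zero a (false ∷ S) (false ∷ T) h c =
    trans (moment-skip-false zero a false S (λ _ _ → refl) T) (moment≡haf zero (minor a) S T (h ∘ suc) c)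
  moment≡haf (suc m) a (false ∷ S) (true ∷ T) h c = contradiction (h zero refl) λ ()
  moment≡haf (suc m) a (false ∷ S) (false ∷ T) h c =
    trans (moment-skip-false (suc m) a false S (λ _ _ → refl) T)
      (moment≡haf (suc m) (minor a) S T (h ∘ suc) c)
  -- Split by the partner of the first vertex. A partner in T contributes 0, because it leaves S but
  -- stays in T. Every other partner contributes `H`. There are |S| - |T| of these in S and 2m + 1 -
  -- |S| outside, so S cancels and `haf-suc` applies.
  moment≡haf (suc m) a (true ∷ S) (false ∷ T) h (s≤s c) =
    trans (moment-true-false m a S T) (trans (cong (1/[1+2× m ] *_) (begin
      sum (λ u → 𝟙 (lookup S u) * moment m (minor a) (S [ u ]≔ false) T) + w * moment m (minor a) S T
        ≡⟨ cong₂ _+_ (sum-cong inside) (outside (ℕP.m≤n⇒m<n∨m≡n c)) ⟩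
      sum (λ u → H * 𝟙 (lookup S u) + (- H) * 𝟙 (lookup T u)) + w * H
        ≡⟨ cong (_+ w * H) (trans (sum-+ (λ u → H * 𝟙 (lookup S u)) (λ u → (- H) * 𝟙 (lookup T u)))
             (cong₂ _+_ (trans (sym (*-sum H (𝟙 ∘ lookup S))) (cong (H *_) (sum-𝟙 S)))
                        (trans (sym (*-sum (- H) (𝟙 ∘ lookup T))) (cong (- H *_) (sum-𝟙 T))))) ⟩
      H * count ∣ S ∣ + (- H) * count ∣ T ∣ + w * H
        ≡⟨ solve 4 (λ o s t H → H :* s :+ (:- H) :* t :+ (o :- s) :* H := (o :- t) :* H) refl
             (1+2× m) (count ∣ S ∣) (count ∣ T ∣) H ⟩
      (1+2× m - count ∣ T ∣) * H
        ≡⟨ haf-suc m (minor a) T (ℕP.≤-trans (card-mono T S (h ∘ suc)) c) ⟩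
      1+2× m * haf (suc m) (minor a) T ∎)) (1+2×-cancel′ m _))
    where
      open ≡-Reasoning
      H w : ℚ
      H = haf m (minor a) T
      w = 1+2× m - count ∣ S ∣
      outside : ∣ S ∣ ℕ.< suc (double m) ⊎ ∣ S ∣ ≡ suc (double m) → w * moment m (minor a) S T ≡ w * H
      outside (inj₁ (s≤s c)) = cong (w *_) (moment≡haf m (minor a) S T (h ∘ suc) c)
      -- Here S is too large for the induction hypothesis, but then no partner is left outside S and
      -- the weight `w` is 0.
      outside (inj₂ eq) = trans (vanish (moment m (minor a) S T)) (sym (vanish H))
        where
          vanish : ∀ p → w * p ≡ 0ℚ
          vanish p = trans
            (cong (_* p) (trans (cong (λ k → 1+2× m - count k) eq) (ℚP.+-inverseʳ (1+2× m))))
            (ℚP.*-zeroˡ p)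
      inside : ∀ u → 𝟙 (lookup S u) * moment m (minor a) (S [ u ]≔ false) T ≡
                     H * 𝟙 (lookup S u) + (- H) * 𝟙 (lookup T u)
      inside u with lookup S u in eqS | lookup T u in eqT
      ... | false | false = solve 2 (λ x H → con 0ℚ :* x := H :* con 0ℚ :+ (:- H) :* con 0ℚ) refl
                              (moment m (minor a) (S [ u ]≔ false) T) H
      ... | false | true  = contradiction (trans (sym eqS) (h (suc u) eqT)) λ ()
      ... | true  | true  = trans
        (cong (1ℚ *_) (moment-outside m (minor a) (S [ u ]≔ false) T u (VecP.lookup∘update u S false) eqT))
        (solve 1 (λ H → con 1ℚ :* con 0ℚ := H :* con 1ℚ :+ (:- H) :* con 1ℚ) refl H)
      ... | true  | false = trans
        (cong (1ℚ *_) (moment≡haf m (minor a) (S [ u ]≔ false) T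
          (⊑-remove T S u (h ∘ suc) eqT) (remove-≤ S u eqS c)))
        (solve 1 (λ H → con 1ℚ :* H := H :* con 1ℚ :+ (:- H) :* con 0ℚ) refl H)
  -- Only partners in T survive: for any other `u`, toggling adds `u` to T while S loses it.
  moment≡haf (suc m) a (true ∷ S) (true ∷ T) h (s≤s c) =
    trans (moment-true-true m a S T) (cong (1/[1+2× m ] *_) (sum-cong term))
    where
      term : ∀ u →
        𝟙 (lookup S u) * (a zero (suc u) * moment m (minor a) (S [ u ]≔ false) (T [ u ]≔ not (lookup T u))) ≡
        𝟙 (lookup T u) * (a zero (suc u) * haf m (minor a) (T [ u ]≔ false))
      term u with lookup S u in eqS | lookup T u in eqT
      ... | false | false = trans (ℚP.*-zeroˡ (a zero (suc u) * moment m (minor a) (S [ u ]≔ false) (T [ u ]≔ true)))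
                              (sym (ℚP.*-zeroˡ (a zero (suc u) * haf m (minor a) (T [ u ]≔ false))))
      ... | false | true  = contradiction (trans (sym eqS) (h (suc u) eqT)) λ ()
      ... | true  | true  = cong (λ t → 1ℚ * (a zero (suc u) * t))
        (moment≡haf m (minor a) (S [ u ]≔ false) (T [ u ]≔ false)
          (⊑-remove (T [ u ]≔ false) S u (λ i q → h (suc i) (remove-⊑ T u i q))
            (VecP.lookup∘update u T false))
          (remove-≤ S u eqS c))
      ... | true  | false = trans
        (cong (λ t → 1ℚ * (a zero (suc u) * t))
          (moment-outside m (minor a) (S [ u ]≔ false) (T [ u ]≔ true) u
            (VecP.lookup∘update u S false) (VecP.lookup∘update u T true)))
        (solve 2 (λ e f → con 1ℚ :* (e :* con 0ℚ) := con 0ℚ :* (e :* f)) refl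
          (a zero (suc u)) (haf m (minor a) (T [ u ]≔ false)))

open import Defs
open Matching

-- Real numbers and linear functionals on polynomials

infix 4 _≐_

-- Equality of representing sequences at every index. Ring identities hold in this finer sense and
-- reduce to the solver on ℚ; `_≈_` enters only where coefficients are known up to a limit.
_≐_ : ℝ → ℝ → Set
x ≐ y = ∀ k → seq x k ≡ seq y k

≐⇒≈ : ∀ x y → x ≐ y → x ≈ y
≐⇒≈ x y h ε 0<ε = 0 , λ n _ → subst (ℚ._≤ ε)
  (trans (cong ℚ.∣_∣ (sym (ℚP.+-inverseʳ (seq y n)))) (cong (λ t → ℚ.∣ t ℚ.- seq y n ∣) (sym (h n))))
  (ℚP.<⇒≤ 0<ε)

≈-sym : ∀ x y → x ≈ y → y ≈ x
≈-sym x y h ε 0<ε = let (N , b) = h ε 0<ε in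
  N , λ n N≤n → subst (ℚ._≤ ε) (ℚLemmas.∣∣-sym (seq x n) (seq y n)) (b n N≤n)

+-cong : ∀ x x′ y y′ → x ≈ x′ → y ≈ y′ → x + y ≈ x′ + y′
+-cong x x′ y y′ h h′ ε 0<ε =
  let (M , b) = h (½ ℚ.* ε) (ℚLemmas.half-pos 0<ε)
      (N , c) = h′ (½ ℚ.* ε) (ℚLemmas.half-pos 0<ε)
  in M ℕ.⊔ N , λ n ≤n → ℚLemmas.+-diff {seq x n} {seq x′ n} {seq y n} {seq y′ n}
       (b n (≤l ≤n)) (c n (≤r {M} ≤n))

≈-trans : ∀ x y z → x ≈ y → y ≈ z → x ≈ z
≈-trans x y z h h′ ε 0<ε =
  let (N , b) = +-cong x y y z h h′ ε 0<ε
  in N , λ n ≤n → subst (λ t → ℚ.∣ t ∣ ℚ.≤ ε)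
       (solve 3 (λ x y z → (x :+ y) :- (y :+ z) := x :- z) refl (seq x n) (seq y n) (seq z n))
       (b n ≤n)

*-congˡ : ∀ c x y → x ≈ y → c * x ≈ c * y
*-congˡ c x y h ε 0<ε =
  let (B , M , 0<B , hB) = bounded c
      (N , b) = h (ε ℚ.* ℚLemmas.inv B 0<B) (ℚLemmas.*-pos 0<ε (ℚLemmas.inv-pos B 0<B))
  in M ℕ.⊔ N , λ n ≤n → subst₂ ℚ._≤_
       (trans (sym (ℚP.∣p*q∣≡∣p∣*∣q∣ (seq c n) (seq x n ℚ.- seq y n)))
         (cong ℚ.∣_∣ (solve 3 (λ c x y → c :* (x :- y) := c :* x :- c :* y) refl
           (seq c n) (seq x n) (seq y n))))
       (ℚLemmas.cancel B 0<B ε)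
       (ℚLemmas.*-mono (ℚP.0≤∣p∣ (seq c n))
         (ℚP.<⇒≤ (ℚLemmas.*-pos 0<ε (ℚLemmas.inv-pos B 0<B)))
         (hB n (≤l ≤n)) (b n (≤r {M} ≤n)))

≈⇒difference≈0 : ∀ x y → x ≈ y → x + (- 1ℝ) * y ≈ 0ℝ
≈⇒difference≈0 x y h ε 0<ε = let (N , b) = h ε 0<ε in N , λ n ≤n → subst (λ t → ℚ.∣ t ∣ ℚ.≤ ε)
  (solve 2 (λ x y → x :- y := (x :+ con (ℚ.- 1ℚ) :* y) :- con 0ℚ) refl (seq x n) (seq y n)) (b n ≤n)

difference≈0⇒≈ : ∀ x y → x + (- 1ℝ) * y ≈ 0ℝ → x ≈ y
difference≈0⇒≈ x y h ε 0<ε = let (N , b) = h ε 0<ε in N , λ n ≤n → subst (λ t → ℚ.∣ t ∣ ℚ.≤ ε)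
  (solve 2 (λ x y → (x :+ con (ℚ.- 1ℚ) :* y) :- con 0ℚ := x :- y) refl (seq x n) (seq y n)) (b n ≤n)

0≤-resp-≈ : ∀ x y → x ≈ y → 0ℝ ≤ x → 0ℝ ≤ y
0≤-resp-≈ x y h p ε 0<ε =
  let (M , b) = h (½ ℚ.* ε) (ℚLemmas.half-pos 0<ε)
      (N , c) = p (½ ℚ.* ε) (ℚLemmas.half-pos 0<ε)
  in M ℕ.⊔ N , λ n ≤n → ℚP.≤-trans (c n (≤r {M} ≤n))
       (subst (seq x n ℚ.+ ½ ℚ.* ε ℚ.≤_)
         (trans (ℚP.+-assoc (seq y n) (½ ℚ.* ε) (½ ℚ.* ε))
           (cong (seq y n ℚ.+_) (ℚLemmas.half+half ε)))
         (ℚP.+-monoˡ-≤ (½ ℚ.* ε) (ℚLemmas.near {seq x n} {seq y n} (b n (≤l ≤n)))))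

0≤-seq : ∀ x → (∀ k → 0ℚ ℚ.≤ seq x k) → 0ℝ ≤ x
0≤-seq x h ε 0<ε = 0 , λ n _ → ℚP.+-mono-≤ (h n) (ℚP.<⇒≤ 0<ε)

0≤x+y : ∀ x y → 0ℝ ≤ x → 0ℝ ≤ y → 0ℝ ≤ x + y
0≤x+y x y h h′ ε 0<ε =
  let (M , b) = h (½ ℚ.* ε) (ℚLemmas.half-pos 0<ε)
      (N , c) = h′ (½ ℚ.* ε) (ℚLemmas.half-pos 0<ε)
  in M ℕ.⊔ N , λ n ≤n → subst (0ℚ ℚ.≤_)
       (trans (solve 3 (λ x y h → (x :+ h) :+ (y :+ h) := (x :+ y) :+ (h :+ h)) refl
           (seq x n) (seq y n) (½ ℚ.* ε))
         (cong ((seq x n ℚ.+ seq y n) ℚ.+_) (ℚLemmas.half+half ε)))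
       (ℚP.+-mono-≤ (b n (≤l ≤n)) (c n (≤r {M} ≤n)))

-- If x, y ≥ - δ then x y ≥ - δ (x + y + δ).
0≤x*y : ∀ x y → 0ℝ ≤ x → 0ℝ ≤ y → 0ℝ ≤ x * y
0≤x*y x y h h′ ε 0<ε =
  let (A , K , 0<A , hA) = bounded x
      (B , L , 0<B , hB) = bounded y
      0<s = ℚP.+-mono-< (ℚP.+-mono-< 0<A 0<B) (ℚP.positive⁻¹ 1ℚ)
      s = (A ℚ.+ B) ℚ.+ 1ℚ
      ε/s = ε ℚ.* ℚLemmas.inv s 0<s
      0<ε/s = ℚLemmas.*-pos 0<ε (ℚLemmas.inv-pos s 0<s)
      δ = ε/s ℚ.⊓ 1ℚ
      0<δ = ⊓-pos 0<ε/s
      (M , b) = h δ 0<δ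
      (N , c) = h′ δ 0<δ
  in (K ℕ.⊔ L) ℕ.⊔ (M ℕ.⊔ N) , λ n ≤n →
       let xn = seq x n
           yn = seq y n
           xn≤A = ℚP.≤-trans (ℚLemmas.≤∣∣ xn) (hA n (≤l {K} (≤l ≤n)))
           yn≤B = ℚP.≤-trans (ℚLemmas.≤∣∣ yn) (hB n (≤r {K} (≤l ≤n)))
           0≤x+δ = b n (≤l {M} (≤r {K ℕ.⊔ L} ≤n))
           0≤y+δ = c n (≤r {M} (≤r {K ℕ.⊔ L} ≤n))
       in ℚP.≤-trans
         (subst (ℚ._≤ (xn ℚ.+ δ) ℚ.* (yn ℚ.+ δ)) (ℚP.*-zeroˡ 0ℚ)
           (ℚLemmas.*-mono ℚP.≤-refl 0≤y+δ 0≤x+δ 0≤y+δ))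
         (subst (ℚ._≤ xn ℚ.* yn ℚ.+ ε)
           (solve 3 (λ x y d → x :* y :+ d :* ((x :+ y) :+ d) := (x :+ d) :* (y :+ d)) refl xn yn δ)
           (ℚP.+-monoʳ-≤ (xn ℚ.* yn) (subst (δ ℚ.* ((xn ℚ.+ yn) ℚ.+ δ) ℚ.≤_)
             (trans (ℚP.*-comm ε/s s) (ℚLemmas.cancel s 0<s ε))
             (ℚP.≤-trans
               (ℚP.*-monoˡ-≤-nonNeg δ {{ℚ.nonNegative (ℚP.<⇒≤ 0<δ)}}
                 (ℚP.+-mono-≤ (ℚP.+-mono-≤ xn≤A yn≤B) (ℚP.p⊓q≤q ε/s 1ℚ)))
               (ℚP.*-monoʳ-≤-nonNeg s {{ℚ.nonNegative (ℚP.<⇒≤ 0<s)}} (ℚP.p⊓q≤p ε/s 1ℚ))))))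
  where
    ⊓-pos : ∀ {p} → 0ℚ ℚ.< p → 0ℚ ℚ.< p ℚ.⊓ 1ℚ
    ⊓-pos {p} h with ℚP.⊓-sel p 1ℚ
    ... | inj₁ eq = subst (0ℚ ℚ.<_) (sym eq) h
    ... | inj₂ eq = subst (0ℚ ℚ.<_) (sym eq) (ℚP.positive⁻¹ 1ℚ)

module _ {n : ℕ} where

  lin : (Monomial n → ℝ) → Poly n → ℝ
  lin φ = foldr (λ (c , α) s → c * φ α + s) 0ℝ

  lin-++ : ∀ φ p q → lin φ (p ++ q) ≐ lin φ p + lin φ q
  lin-++ φ []            q k = sym (ℚP.+-identityˡ _)
  lin-++ φ ((c , α) ∷ p) q k = trans (cong (seq (c * φ α) k ℚ.+_) (lin-++ φ p q k))
    (sym (ℚP.+-assoc (seq (c * φ α) k) (seq (lin φ p) k) (seq (lin φ q) k)))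

  lin-· : ∀ φ a p → lin φ (a ·ₚ p) ≐ a * lin φ p
  lin-· φ a []            k = sym (ℚP.*-zeroʳ (seq a k))
  lin-· φ a ((c , α) ∷ p) k = trans
    (cong (seq ((a * c) * φ α) k ℚ.+_) (lin-· φ a p k))
    (solve 4 (λ a c f s → (a :* c) :* f :+ a :* s := a :* (c :* f :+ s)) refl
      (seq a k) (seq c k) (seq (φ α) k) (seq (lin φ p) k))

  lin-cong : ∀ φ ψ p → (∀ α → φ α ≈ ψ α) → lin φ p ≈ lin ψ p
  lin-cong φ ψ []            h = ≐⇒≈ 0ℝ 0ℝ λ _ → refl
  lin-cong φ ψ ((c , α) ∷ p) h = +-cong (c * φ α) (c * ψ α) (lin φ p) (lin ψ p)
    (*-congˡ c (φ α) (ψ α) (h α)) (lin-cong φ ψ p h)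

  lin-shift : ∀ φ (f : Monomial n → Monomial n) c q →
    lin φ (map (λ (d , β) → c * d , f β) q) ≐ c * lin (φ ∘ f) q
  lin-shift φ f c []            k = sym (ℚP.*-zeroʳ (seq c k))
  lin-shift φ f c ((d , β) ∷ q) k = trans
    (cong (seq ((c * d) * φ (f β)) k ℚ.+_) (lin-shift φ f c q k))
    (solve 4 (λ a c f s → (a :* c) :* f :+ a :* s := a :* (c :* f :+ s)) refl
      (seq c k) (seq d k) (seq (φ (f β)) k) (seq (lin (φ ∘ f) q) k))

  -- As an iterated functional, a product can be evaluated, or replaced by equivalent polynomials,
  -- one factor at a time.
  lin-*ₚ : ∀ φ p q → lin φ (p *ₚ q) ≐ lin (λ α → lin (λ β → φ (zipWith ℕ._+_ α β)) q) p
  lin-*ₚ φ []            q k = refl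
  lin-*ₚ φ ((c , α) ∷ p) q k = trans
    (lin-++ φ (map (λ (d , β) → c * d , zipWith ℕ._+_ α β) q) (p *ₚ q) k)
    (cong₂ ℚ._+_ (lin-shift φ (zipWith ℕ._+_ α) c q k) (lin-*ₚ φ p q k))

  coeff-++ : ∀ (p q : Poly n) α → coeff (p ++ q) α ≐ coeff p α + coeff q α
  coeff-++ []            q α k = sym (ℚP.+-identityˡ _)
  coeff-++ ((c , β) ∷ p) q α k with does (VecP.≡-dec ℕP._≟_ β α)
  ... | false = coeff-++ p q α k
  ... | true  = trans (cong (seq c k ℚ.+_) (coeff-++ p q α k))
    (sym (ℚP.+-assoc (seq c k) (seq (coeff p α) k) (seq (coeff q α) k)))

  coeff-· : ∀ a (p : Poly n) α → coeff (a ·ₚ p) α ≐ a * coeff p α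
  coeff-· a []            α k = sym (ℚP.*-zeroʳ (seq a k))
  coeff-· a ((c , β) ∷ p) α k with does (VecP.≡-dec ℕP._≟_ β α)
  ... | false = coeff-· a p α k
  ... | true  = trans (cong (seq (a * c) k ℚ.+_) (coeff-· a p α k))
    (sym (ℚP.*-distribˡ-+ (seq a k) (seq c k) (seq (coeff p α) k)))

  restrict : ∀ {P : Monomial n → Set} → Decidable P → Poly n → Poly n
  restrict P? = filter (P? ∘ proj₂)

  coeff-restrict : ∀ {P : Monomial n → Set} (P? : Decidable P) p α →
    coeff (restrict P? p) α ≡ (if does (P? α) then coeff p α else 0ℝ)
  coeff-restrict P? [] α with does (P? α)
  ... | false = refl
  ... | true  = refl
  coeff-restrict P? ((c , β) ∷ p) α with VecP.≡-dec ℕP._≟_ β α | does (P? β) in eq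
  ... | no _     | false = coeff-restrict P? p α
  -- The filtered list shows its head only once `P? β` is decided, so the comparison of `β` with `α`
  -- reappears and is abstracted a second time.
  ... | no β≢α   | true  with VecP.≡-dec ℕP._≟_ β α
  ...   | no _    = coeff-restrict P? p α
  ...   | yes β≡α = contradiction β≡α β≢α
  coeff-restrict P? ((c , β) ∷ p) α | yes refl | false rewrite eq =
    trans (coeff-restrict P? p α) (cong (λ b → if b then coeff p α else 0ℝ) eq)
  coeff-restrict P? ((c , β) ∷ p) α | yes refl | true with VecP.≡-dec ℕP._≟_ β α
  ...   | no β≢α = contradiction refl β≢α
  ...   | yes _ rewrite eq = cong (c +_)
    (trans (coeff-restrict P? p α) (cong (λ b → if b then coeff p α else 0ℝ) eq))

  -- A polynomial depending only on S may still list terms outside S whose coefficients cancel in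
  -- the limit. Filtering removes them from the list.
  restrict-≈ₚ : ∀ {P : Monomial n → Set} (P? : Decidable P) p →
    (∀ α → ¬ P α → coeff p α ≈ 0ℝ) → p ≈ₚ restrict P? p
  restrict-≈ₚ P? p h α rewrite coeff-restrict P? p α with P? α
  ... | yes _  = ≐⇒≈ (coeff p α) (coeff p α) λ _ → refl
  ... | no ¬Pα = h α ¬Pα

  without : Monomial n → Poly n → Poly n
  without α = restrict λ β → ¬? (VecP.≡-dec ℕP._≟_ β α)

  lin-without : ∀ φ p α → lin φ p ≐ coeff p α * φ α + lin φ (without α p)
  lin-without φ [] α k = solve 1 (λ f → con 0ℚ := con 0ℚ :* f :+ con 0ℚ) refl (seq (φ α) k)
  lin-without φ ((c , β) ∷ p) α k with VecP.≡-dec ℕP._≟_ β α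
  ... | yes refl = trans (cong (seq (c * φ α) k ℚ.+_) (lin-without φ p α k))
    (solve 4 (λ c f a s → c :* f :+ (a :* f :+ s) := (c :+ a) :* f :+ s) refl
      (seq c k) (seq (φ α) k) (seq (coeff p α) k) (seq (lin φ (without α p)) k))
  ... | no _ = trans (cong (seq (c * φ β) k ℚ.+_) (lin-without φ p α k))
    (solve 3 (λ x y z → x :+ (y :+ z) := y :+ (x :+ z)) refl
      (seq (c * φ β) k) (seq (coeff p α * φ α) k) (seq (lin φ (without α p)) k))

  length-without : ∀ c α p → length (without α ((c , α) ∷ p)) ℕ.≤ length p
  length-without c α p with VecP.≡-dec ℕP._≟_ α α
  ... | yes _  = ListP.length-filter (λ t → ¬? (VecP.≡-dec ℕP._≟_ (proj₂ t) α)) p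
  ... | no α≢α = contradiction refl α≢α

  -- Induction on a bound for the number of terms, removing all terms with the
  -- leading monomial at once: only their sum is known to vanish.
  lin-zero : ∀ φ l p → length p ℕ.≤ l → (∀ α → coeff p α ≈ 0ℝ) → lin φ p ≈ 0ℝ
  lin-zero φ l       []                h z = ≐⇒≈ 0ℝ 0ℝ λ _ → refl
  lin-zero φ (suc l) p@((c , α) ∷ p′) (s≤s h) z =
    ≈-trans (lin φ p) (coeff p α * φ α + lin φ (without α p)) 0ℝ
      (≐⇒≈ (lin φ p) (coeff p α * φ α + lin φ (without α p)) (lin-without φ p α))
      (≈-trans (coeff p α * φ α + lin φ (without α p)) (0ℝ + 0ℝ) 0ℝ
        (+-cong (coeff p α * φ α) 0ℝ (lin φ (without α p)) 0ℝ
          (≈-trans (coeff p α * φ α) (φ α * coeff p α) 0ℝ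
            (≐⇒≈ (coeff p α * φ α) (φ α * coeff p α) λ k → ℚP.*-comm (seq (coeff p α) k) (seq (φ α) k))
            (≈-trans (φ α * coeff p α) (φ α * 0ℝ) 0ℝ
              (*-congˡ (φ α) (coeff p α) 0ℝ (z α))
              (≐⇒≈ (φ α * 0ℝ) 0ℝ λ k → ℚP.*-zeroʳ (seq (φ α) k))))
          (lin-zero φ l (without α p) (ℕP.≤-trans (length-without c α p′) h) z′))
        (≐⇒≈ (0ℝ + 0ℝ) 0ℝ λ _ → refl))
    where
      z′ : ∀ β → coeff (without α p) β ≈ 0ℝ
      z′ β rewrite coeff-restrict (λ γ → ¬? (VecP.≡-dec ℕP._≟_ γ α)) p β with VecP.≡-dec ℕP._≟_ β α
      ... | yes _ = ≐⇒≈ 0ℝ 0ℝ λ _ → refl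
      ... | no  _ = z β

  lin-resp-≈ₚ : ∀ φ p q → p ≈ₚ q → lin φ p ≈ lin φ q
  lin-resp-≈ₚ φ p q h = difference≈0⇒≈ (lin φ p) (lin φ q)
    (≈-trans (lin φ p + (- 1ℝ) * lin φ q) (lin φ (p -ₚ q)) 0ℝ
      (≐⇒≈ (lin φ p + (- 1ℝ) * lin φ q) (lin φ (p -ₚ q)) λ k → sym
        (trans (lin-++ φ p ((- 1ℝ) ·ₚ q) k) (cong (seq (lin φ p) k ℚ.+_) (lin-· φ (- 1ℝ) q k))))
      (lin-zero φ _ (p -ₚ q) ℕP.≤-refl λ α →
        ≈-trans (coeff (p -ₚ q) α) (coeff p α + (- 1ℝ) * coeff q α) 0ℝ
          (≐⇒≈ (coeff (p -ₚ q) α) (coeff p α + (- 1ℝ) * coeff q α) λ k →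
            trans (coeff-++ p ((- 1ℝ) ·ₚ q) α k) (cong (seq (coeff p α) k ℚ.+_) (coeff-· (- 1ℝ) q α k)))
          (≈⇒difference≈0 (coeff p α) (coeff q α) (h α))))

-- Soundness

odd? : ℕ → Bool
odd? zero    = false
odd? (suc k) = not (odd? k)

odd?-+ : ∀ i j → odd? (i ℕ.+ j) ≡ odd? i xor odd? j
odd?-+ zero    j = refl
odd?-+ (suc i) j = trans (cong not (odd?-+ i j)) (BoolP.not-distribˡ-xor (odd? i) (odd? j))

odds : ∀ {n} → Monomial n → Subset n
odds = Vec.map odd?

odds-+ : ∀ {n} (α β : Monomial n) → odds (zipWith ℕ._+_ α β) ≡ zipWith _xor_ (odds α) (odds β)
odds-+ []      []      = refl
odds-+ (i ∷ α) (j ∷ β) = cong₂ _∷_ (odd?-+ i j) (odds-+ α β)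

xor-self : ∀ {n} (T : Subset n) → zipWith _xor_ T T ≡ replicate n false
xor-self []      = refl
xor-self (b ∷ T) = cong₂ _∷_ (BoolP.xor-same b) (xor-self T)

Supported : ∀ {n} → Subset n → Monomial n → Set
Supported S α = ∀ i → i ∉ S → lookup α i ≡ 0

supported? : ∀ {n} (S : Subset n) α → Dec (Supported S α)
supported? S α = FinP.all? λ i → ¬? (i ∈? S) →-dec (lookup α i ℕP.≟ 0)

-- The moments of odd degree vanish and no boolean axiom changes parities, so
-- only the set of indeterminates with odd exponents matters.
module PseudoExpectation {n} (m : ℕ) (a : Matrix n) where

  φ : Monomial n → ℝ
  φ α = fromℚ (haf m a (odds α))

  Ẽ : Poly n → ℝ
  Ẽ = lin φ

  Ẽ-bool : ∀ u s → Ẽ ((X u *ₚ X u -ₚ const 1ℝ) *ₚ s) ≐ 0ℝ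
  Ẽ-bool u s k = trans (lin-*ₚ φ (X u *ₚ X u -ₚ const 1ℝ) s k)
    (trans (cong (λ t → (1ℚ ℚ.* 1ℚ) ℚ.* t ℚ.+ ((ℚ.- 1ℚ ℚ.* 1ℚ) ℚ.* seq E₀ k ℚ.+ 0ℚ)) (shift s))
      (solve 1 (λ t → (con 1ℚ :* con 1ℚ) :* t :+ ((:- con 1ℚ :* con 1ℚ) :* t :+ con 0ℚ) := con 0ℚ)
        refl (seq E₀ k)))
    where
      e : Monomial n
      e = replicate n 0 [ u ]≔ 1
      E₀ : ℝ
      E₀ = lin (λ β → φ (zipWith ℕ._+_ (replicate n 0) β)) s
      parity : ∀ β → odds (zipWith ℕ._+_ (zipWith ℕ._+_ e e) β) ≡ odds (zipWith ℕ._+_ (replicate n 0) β)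
      parity β = trans (odds-+ (zipWith ℕ._+_ e e) β) (trans
        (cong (λ T → zipWith _xor_ T (odds β)) (trans (odds-+ e e)
          (trans (xor-self (odds e)) (sym (VecP.map-replicate odd? 0 n)))))
        (sym (odds-+ (replicate n 0) β)))
      shift : ∀ s → seq (lin (λ β → φ (zipWith ℕ._+_ (zipWith ℕ._+_ e e) β)) s) k ≡
                    seq (lin (λ β → φ (zipWith ℕ._+_ (replicate n 0) β)) s) k
      shift []            = refl
      shift ((c , β) ∷ s) = cong₂ (λ t t′ → seq c k ℚ.* t ℚ.+ t′)
        (cong (haf m a) (parity β)) (shift s)

  -- The value at a sign vector with each coefficient replaced by its `k`-th approximation; at
  -- signs, the monomial of `α` equals the character of `odds α`.
  eval : ℕ → Poly n → Vec Sign n → ℚ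
  eval k p x = foldr (λ (c , α) s → seq c k ℚ.* χ (odds α) x ℚ.+ s) 0ℚ p

  module _ (S : Subset n) (S≤ : ∣ S ∣ ℕ.≤ double m) where

    private
      D : Vec Sign n → ℚ
      D = density m a S

    supported-⊑ : ∀ α β → Supported S α → Supported S β → odds (zipWith ℕ._+_ α β) ⊑ S
    supported-⊑ α β hα hβ i h with i ∈? S
    ... | yes i∈S = VecP.[]=⇒lookup i∈S
    ... | no  i∉S = contradiction
      (trans (sym h) (trans (VecP.lookup-map i odd? (zipWith ℕ._+_ α β))
        (cong odd? (trans (VecP.lookup-zipWith ℕ._+_ i α β) (cong₂ ℕ._+_ (hα i i∉S) (hβ i i∉S))))))
      λ ()

    haf≡avg : ∀ α β → Supported S α → Supported S β →
      haf m a (odds (zipWith ℕ._+_ α β)) ≡ avg (λ x → D x ℚ.* (χ (odds α) x ℚ.* χ (odds β) x))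
    haf≡avg α β hα hβ = trans (sym (moment≡haf m a S (odds (zipWith ℕ._+_ α β))
        (supported-⊑ α β hα hβ) S≤))
      (avg-cong λ x → cong (D x ℚ.*_)
        (trans (cong (λ T → χ T x) {x = odds (zipWith ℕ._+_ α β)} (odds-+ α β))
          (χ-xor (odds α) (odds β) x)))

    -- The free factor `g` allows two uses for a square: a character for the inner functional, then
    -- the value of the polynomial for the outer one.
    lin≡avg : ∀ k (g : Vec Sign n → ℚ) ψ p →
      All (λ (c , α) → seq (ψ α) k ≡ avg (λ x → D x ℚ.* (χ (odds α) x ℚ.* g x))) p →
      seq (lin ψ p) k ≡ avg (λ x → D x ℚ.* (eval k p x ℚ.* g x))
    lin≡avg k g ψ [] h = sym (avg-zero _ λ x →
      solve 2 (λ d g → d :* (con 0ℚ :* g) := con 0ℚ) refl (D x) (g x))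
    lin≡avg k g ψ ((c , α) ∷ p) (h ∷ hs) = trans
      (cong₂ ℚ._+_ (trans (cong (seq c k ℚ.*_) h) (sym (avg-* (seq c k) _))) (lin≡avg k g ψ p hs))
      (trans (sym (avg-+ _ _)) (avg-cong λ x →
        solve 5 (λ c d t g s → c :* (d :* (t :* g)) :+ d :* (s :* g) := d :* ((c :* t :+ s) :* g)) refl
          (seq c k) (D x) (χ (odds α) x) (g x) (eval k p x)))

    Ẽ-square : ∀ k p → All (λ (_ , α) → Supported S α) p →
      seq (Ẽ (p *ₚ p)) k ≡ avg (λ x → D x ℚ.* (eval k p x ℚ.* eval k p x))
    Ẽ-square k p h = trans (lin-*ₚ φ p p k)
      (lin≡avg k (eval k p) (λ α → lin (λ β → φ (zipWith ℕ._+_ α β)) p) p (outer p h))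
      where
        inner : ∀ α → Supported S α → ∀ q → All (λ (c , β) → Supported S β) q →
          All (λ (c , β) → haf m a (odds (zipWith ℕ._+_ α β)) ≡
            avg (λ x → D x ℚ.* (χ (odds β) x ℚ.* χ (odds α) x))) q
        inner α hα []            []       = []
        inner α hα ((c , β) ∷ q) (h ∷ hs) = trans (haf≡avg α β hα h)
          (avg-cong λ x → cong (D x ℚ.*_) (ℚP.*-comm (χ (odds α) x) (χ (odds β) x))) ∷ inner α hα q hs
        outer : ∀ q → All (λ (c , β) → Supported S β) q →
          All (λ (c , α) → seq (lin (λ β → φ (zipWith ℕ._+_ α β)) p) k ≡
            avg (λ x → D x ℚ.* (χ (odds α) x ℚ.* eval k p x))) q
        outer []            []       = []
        outer ((c , α) ∷ q) (hα ∷ hs) = trans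
          (lin≡avg k (χ (odds α)) (λ β → φ (zipWith ℕ._+_ α β)) p (inner α hα p h))
          (avg-cong λ x → cong (D x ℚ.*_) (ℚP.*-comm (eval k p x) (χ (odds α) x))) ∷ outer q hs

    unsupported : ∀ p → DependsOnlyOn S p → ∀ α → ¬ Supported S α → coeff p α ≈ 0ℝ
    unsupported p h α ¬hα =
      let (i , ¬hi) = FinP.¬∀⟶∃¬ n (λ i → i ∉ S → lookup α i ≡ 0)
                        (λ i → ¬? (i ∈? S) →-dec (lookup α i ℕP.≟ 0)) ¬hα
      in h α i (λ i∈S → ¬hi λ i∉S → contradiction i∈S i∉S) (λ eq → ¬hi λ _ → eq)

    -- For the filtered polynomial `q`, every approximant of Ẽ(q²) is an average of a nonnegative
    -- density times a rational square. Passing from `q` back to `p`, one factor at a time, is the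
    -- only step that holds merely in the limit.
    0≤Ẽ-square : Bounded a → ∀ p → DependsOnlyOn S p → 0ℝ ≤ Ẽ (p *ₚ p)
    0≤Ẽ-square b p h = 0≤-resp-≈ (Ẽ (q *ₚ q)) (Ẽ (p *ₚ p)) q²≈p² (0≤-seq (Ẽ (q *ₚ q)) λ k →
      subst (0ℚ ℚ.≤_) (sym (Ẽ-square k q (AllP.all-filter (supported? S ∘ proj₂) p)))
        (0≤avg _ λ x → 0≤* (0≤density m a S x b S≤) (0≤² (eval k q x))))
      where
        q : Poly n
        q = restrict (supported? S) p
        ψ : Poly n → Monomial n → ℝ
        ψ r α = lin (λ β → φ (zipWith ℕ._+_ α β)) r
        p≈q : p ≈ₚ q
        p≈q = restrict-≈ₚ (supported? S) p (unsupported p h)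
        q²≈p² : Ẽ (q *ₚ q) ≈ Ẽ (p *ₚ p)
        q²≈p² = ≈-sym (Ẽ (p *ₚ p)) (Ẽ (q *ₚ q))
          (≈-trans (Ẽ (p *ₚ p)) (lin (ψ p) p) (Ẽ (q *ₚ q))
            (≐⇒≈ (Ẽ (p *ₚ p)) (lin (ψ p) p) (lin-*ₚ φ p p))
            (≈-trans (lin (ψ p) p) (lin (ψ p) q) (Ẽ (q *ₚ q))
              (lin-resp-≈ₚ (ψ p) p q p≈q)
              (≈-trans (lin (ψ p) q) (lin (ψ q) q) (Ẽ (q *ₚ q))
                (lin-cong (ψ p) (ψ q) q λ α → lin-resp-≈ₚ (λ β → φ (zipWith ℕ._+_ α β)) p q p≈q)
                (≐⇒≈ (lin (ψ q) q) (Ẽ (q *ₚ q)) λ k → sym (lin-*ₚ φ q q k)))))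
        0≤² : ∀ p → 0ℚ ℚ.≤ p ℚ.* p
        0≤² p with ℚP.≤-total 0ℚ p
        ... | inj₁ 0≤p = 0≤* 0≤p 0≤p
        ... | inj₂ p≤0 = subst (0ℚ ℚ.≤_) (solve 1 (λ p → (:- p) :* (:- p) := p :* p) refl p)
          (0≤* (ℚP.neg-antimono-≤ p≤0) (ℚP.neg-antimono-≤ p≤0))

  module _ (b : Bounded a) {R} (R≤ : R ℕ.≤ double m) where

    sound    : ∀ {p} → R ⊢ p ≥0 → 0ℝ ≤ Ẽ p
    -- Separate from `sound` so that the recursion through the list of premises is visibly
    -- structural.
    sound-combine : ∀ ls → All (λ (c , p) → 0ℝ ≤ c × (R ⊢ p ≥0)) ls →
      0ℝ ≤ Ẽ (sumₚ (List.map (λ (c , p) → c ·ₚ p) ls))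

    sound (square p (S , S≤R , h)) = 0≤Ẽ-square S (ℕP.≤-trans S≤R R≤) b p h
    sound (bool≥ u s _) = 0≤-seq (Ẽ ((X u *ₚ X u -ₚ const 1ℝ) *ₚ s)) λ k →
      ℚP.≤-reflexive (sym (Ẽ-bool u s k))
    sound (bool≤ u s _) = 0≤-seq (Ẽ ((- 1ℝ) ·ₚ ((X u *ₚ X u -ₚ const 1ℝ) *ₚ s))) λ k →
      ℚP.≤-reflexive (sym
      (trans (lin-· φ (- 1ℝ) ((X u *ₚ X u -ₚ const 1ℝ) *ₚ s) k)
        (trans (cong (ℚ.- 1ℚ ℚ.*_) (Ẽ-bool u s k)) (ℚP.*-zeroʳ (ℚ.- 1ℚ)))))
    sound (combine ls h) = sound-combine ls h
    sound (respect {p} {q} p≈q h) = 0≤-resp-≈ (Ẽ p) (Ẽ q) (lin-resp-≈ₚ φ p q p≈q) (sound h)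

    sound-combine []             []             = 0≤-seq 0ℝ λ _ → ℚP.≤-refl
    sound-combine ((c , p) ∷ ls) ((0≤c , h) ∷ hs) =
      0≤-resp-≈ (c * Ẽ p + Ẽ rest) (Ẽ (c ·ₚ p +ₚ rest))
        (≐⇒≈ (c * Ẽ p + Ẽ rest) (Ẽ (c ·ₚ p +ₚ rest)) λ k → sym
          (trans (lin-++ φ (c ·ₚ p) rest k) (cong (ℚ._+ seq (Ẽ rest) k) (lin-· φ c p k))))
        (0≤x+y (c * Ẽ p) (Ẽ rest) (0≤x*y c (Ẽ p) 0≤c (sound h)) (sound-combine ls hs))
      where
        rest : Poly n
        rest = sumₚ (List.map (λ (c , p) → c ·ₚ p) ls)

-- The value of the pseudo-expectation

sum-single : ∀ {n} (f : Fin n → ℚ) j → (∀ u → u ≢ j → f u ≡ 0ℚ) → sum f ≡ f j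
sum-single f zero h = trans (sum-∷ f) (trans
  (cong (f zero ℚ.+_) (sum-zero (f ∘ suc) λ u → h (suc u) λ ())) (ℚP.+-identityʳ (f zero)))
sum-single f (suc j) h = trans (sum-∷ f) (trans
  (cong₂ ℚ._+_ (h zero λ ()) (sum-single (f ∘ suc) j λ u u≢j → h (suc u) (u≢j ∘ FinP.suc-injective)))
  (ℚP.+-identityˡ (f (suc j))))

haf-∅ : ∀ {n} m (a : Matrix n) → haf m a (replicate n false) ≡ 1ℚ
haf-∅ {zero}  m a = refl
haf-∅ {suc n} m a = haf-∅ m (minor a)

odds-one : ∀ {n} → odds (replicate n 0) ≡ replicate n false
odds-one {n} = VecP.map-replicate odd? 0 n

odds-X : ∀ {n} (i : Fin n) → odds (replicate n 0 [ i ]≔ 1) ≡ replicate n false [ i ]≔ true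
odds-X {n} i = trans (VecP.map-[]≔ odd? (replicate n 0) i) (cong (_[ i ]≔ true) odds-one)

-- 1/(2m + 1) is the probability that `i` and `j` are matched. In the expansion at `i`, only the
-- partner `j` is left, and removing it leaves the empty set.
haf-pair : ∀ {n} m (a : Matrix n) {i j} → i <ᶠ j →
  haf (suc m) a (odds (zipWith ℕ._+_ (replicate n 0 [ i ]≔ 1) (replicate n 0 [ j ]≔ 1))) ≡
  1/[1+2× m ] ℚ.* a i j
haf-pair {suc n} m a {zero} {suc j} _ = trans
  (cong (λ T → haf (suc m) a (true ∷ T)) (trans
    (cong odds (VecP.zipWith-identityˡ ℕP.+-identityˡ (replicate n 0 [ j ]≔ 1))) (odds-X j)))
  (cong (1/[1+2× m ] ℚ.*_) (trans
    (sum-single _ j λ u u≢j → 𝟙-false _ (trans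
      (VecP.lookup∘update′ u≢j (replicate n false) true) (VecP.lookup-replicate u false)))
    (trans (cong₂ (λ b T → 𝟙 b ℚ.* (a zero (suc j) ℚ.* haf m (minor a) T))
        (VecP.lookup∘update j (replicate n false) true)
        (trans (VecP.[]≔-idempotent (replicate n false) j)
          (trans (cong (replicate n false [ j ]≔_) (sym (VecP.lookup-replicate j false)))
            (VecP.[]≔-lookup (replicate n false) j))))
      (trans (cong (λ t → 1ℚ ℚ.* (a zero (suc j) ℚ.* t)) (haf-∅ m (minor a)))
        (solve 1 (λ e → con 1ℚ :* (e :* con 1ℚ) := e) refl (a zero (suc j)))))))
haf-pair {suc n} m a {suc i} {suc j} (s≤s i<j) = haf-pair m (minor a) i<j

signs : ∀ {n} {G : SimpleGraph n} → EdgeSigns G → Matrix n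
signs b i j = σ (sign b i j)

signs-bounded : ∀ {n} {G : SimpleGraph n} (b : EdgeSigns G) → Bounded (signs b)
signs-bounded b i j s = subst (λ t → 0ℚ ℚ.≤ 1ℚ ℚ.+ t) (sym (σ-* (sign b i j) s))
  (0≤1+σ (sign b i j Sign.* s))
  where
    0≤1+σ : ∀ s → 0ℚ ℚ.≤ 1ℚ ℚ.+ σ s
    0≤1+σ Sign.+ = 0≤+ 0≤1 0≤1
    0≤1+σ Sign.- = ℚP.≤-refl

seq-⟦⟧ : ∀ s k → seq ⟦ s ⟧ k ≡ σ s
seq-⟦⟧ Sign.+ k = refl
seq-⟦⟧ Sign.- k = refl

lin-sumₚ : ∀ {A : Set} {n} (φ : Monomial n → ℝ) c k (f : A → Poly n) xs →
  All (λ x → seq (lin φ (f x)) k ≡ c) xs →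
  seq (lin φ (sumₚ (List.map f xs))) k ≡ count (length xs) ℚ.* c
lin-sumₚ φ c k f []       []       = sym (ℚP.*-zeroˡ c)
lin-sumₚ φ c k f (x ∷ xs) (h ∷ hs) = trans (lin-++ φ (f x) (sumₚ (List.map f xs)) k)
  (trans (cong₂ ℚ._+_ h (lin-sumₚ φ c k f xs hs))
    (solve 2 (λ c l → c :+ l :* c := (con 1ℚ :+ l) :* c) refl c (count (length xs))))

toℚᵘ-count : ∀ k → ℚ.toℚᵘ (count k) ℚᵘ.≃ ℚᵘ.mkℚᵘ (ℤ.+ k) 0
toℚᵘ-count zero    = ℚᵘP.≃-refl
toℚᵘ-count (suc k) = ℚᵘP.≃-trans (ℚP.toℚᵘ-homo-+ 1ℚ (count k))
  (ℚᵘP.≃-trans (ℚᵘP.+-congʳ ℚᵘ.1ℚᵘ (toℚᵘ-count k))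
    (ℚᵘ.*≡* (cong (ℤ._* (ℤ.+ 1)) (cong (λ t → ℤ.1ℤ ℤ.+ t) (ℤP.*-identityʳ (ℤ.+ k))))))

count≡/1 : ∀ k → count k ≡ ℤ.+ k / 1
count≡/1 k = ℚP.toℚᵘ-injective
  (ℚᵘP.≃-trans (toℚᵘ-count k) (ℚᵘP.≃-sym (ℚP.toℚᵘ-fromℚᵘ (ℚᵘ.mkℚᵘ (ℤ.+ k) 0))))

1/*count : ∀ k .{{_ : NonZero k}} → ℤ.+ 1 / k ℚ.* count k ≡ 1ℚ
1/*count (suc k) = ℚP.toℚᵘ-injective
  (ℚᵘP.≃-trans (ℚP.toℚᵘ-homo-* (ℤ.+ 1 / suc k) (count (suc k)))
    (ℚᵘP.≃-trans (ℚᵘP.*-cong (ℚP.toℚᵘ-fromℚᵘ (ℚᵘ.mkℚᵘ (ℤ.+ 1) k)) (toℚᵘ-count (suc k)))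
      (ℚᵘ.*≡* (cong (λ t → ℤ.+ suc t)
        (trans (ℕP.*-identityʳ (k ℕ.+ 0)) (cong (ℕ._+ 0) (sym (ℕP.*-identityʳ k))))))))

module _ {n} (G : SimpleGraph n) .{{_ : NonZero (edgeCount G)}} (b : EdgeSigns G) (m : ℕ) where

  open PseudoExpectation (suc m) (signs b)

  value : ℚ
  value = ½ ℚ.+ ½ ℚ.* 1/[1+2× m ]

  Ẽ-const : ∀ c → Ẽ (const c) ≐ c
  Ẽ-const c k = trans
    (cong (λ t → seq c k ℚ.* t ℚ.+ 0ℚ)
      (trans (cong (haf (suc m) (signs b)) odds-one) (haf-∅ (suc m) (signs b))))
    (solve 1 (λ c → c :* con 1ℚ :+ con 0ℚ := c) refl (seq c k))

  term : Fin n × Fin n → Poly n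
  term (i , j) = const (fromℚ ½) +ₚ (fromℚ ½ * ⟦ sign b i j ⟧) ·ₚ (X i *ₚ X j)

  Ẽ-term : ∀ k {i j} → i <ᶠ j → seq (Ẽ (term (i , j))) k ≡ value
  Ẽ-term k {i} {j} i<j = trans
    (cong₂ (λ t t′ → ½ ℚ.* t ℚ.+ t′)
      (trans (cong (haf (suc m) (signs b)) odds-one) (haf-∅ (suc m) (signs b)))
      (cong₂ (λ s t → ((½ ℚ.* s) ℚ.* (1ℚ ℚ.* 1ℚ)) ℚ.* t ℚ.+ 0ℚ)
        (seq-⟦⟧ (sign b i j) k) (haf-pair m (signs b) i<j)))
    (trans (solve 2 (λ s r →
        con ½ :* con 1ℚ :+ (((con ½ :* s) :* (con 1ℚ :* con 1ℚ)) :* (r :* s) :+ con 0ℚ) :=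
        con ½ :+ con ½ :* (r :* (s :* s))) refl (σ (sign b i j)) 1/[1+2× m ])
      (cong (λ t → ½ ℚ.+ ½ ℚ.* t) (trans (cong (1/[1+2× m ] ℚ.*_) (σ² (sign b i j)))
        (ℚP.*-identityʳ 1/[1+2× m ]))))

  Ẽ-OBJ : ∀ k → seq (Ẽ (OBJ G b)) k ≡ value
  Ẽ-OBJ k = trans (lin-· φ (fromℚ (ℤ.+ 1 / edgeCount G)) (sumₚ (List.map term (edges G))) k)
    (trans (cong (ℤ.+ 1 / edgeCount G ℚ.*_) (lin-sumₚ φ value k term (edges G)
        (All.map (λ (i<j , _) → Ẽ-term k i<j)
          (AllP.all-filter (λ (i , j) → (i FinP.<? j) ×-dec adj? G i j)
            (cartesianProduct (allFin n) (allFin n))))))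
      (trans (sym (ℚP.*-assoc (ℤ.+ 1 / edgeCount G) (count (edgeCount G)) value))
        (trans (cong (ℚ._* value) (1/*count (edgeCount G))) (ℚP.*-identityˡ value))))

  Ẽ-gap : ∀ v k → seq (Ẽ (const v -ₚ OBJ G b)) k ≡ seq v k ℚ.- value
  Ẽ-gap v k = trans (lin-++ φ (const v) ((- 1ℝ) ·ₚ OBJ G b) k)
    (cong₂ ℚ._+_ (Ẽ-const v k)
      (trans (lin-· φ (- 1ℝ) (OBJ G b) k)
        (trans (cong (ℚ.- 1ℚ ℚ.*_) (Ẽ-OBJ k))
          (solve 1 (λ c → con (ℚ.- 1ℚ) :* c := :- c) refl value))))

-- Comparison with the claimed bound

2≤π : ∀ n → 19 ℕ.≤ n → ℤ.+ 2 / 1 ℚ.≤ πseq n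
-- The quarter disk of radius 5 contains 15 unit squares, so `πseq 4` is 60/25 = 12/5; from index 19
-- on, the error is at most 8/20 = 2/5.
2≤π n 19≤n = subst₂ ℚ._≤_ refl
  (solve 1 (λ p → (p :+ con (ℤ.+ 2 / 5)) :- con (ℤ.+ 2 / 5) := p) refl (πseq n))
  (ℚP.+-monoˡ-≤ (ℚ.- (ℤ.+ 2 / 5))
    (ℚP.≤-trans (πseq-near 4 n) (ℚP.+-monoʳ-≤ (πseq n) (8/-anti 19≤n))))

-- `suc m` is R/2 rounded up. The upper bound on R gives soundness for R rounds, the lower one makes
-- the value at least 1/2 + 1/(2R).
half-odd : ∀ R .{{_ : NonZero R}} → ∃ λ m → suc (double m) ℕ.≤ R × R ℕ.≤ double (suc m)
half-odd 1 = 0 , s≤s z≤n , s≤s z≤n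
half-odd 2 = 0 , s≤s z≤n , s≤s (s≤s z≤n)
half-odd (suc (suc R@(suc _))) =
  let (m , h , h′) = half-odd R in suc m , s≤s (s≤s h) , s≤s (s≤s h′)

-- The cut-off in `recip` can only enlarge the denominator, so an upper bound holds at each index
-- whatever δ is.
recip≤inv : ∀ x (0<x : 0ℝ < x) k p (0<p : 0ℚ ℚ.< p) → p ℚ.≤ seq x k →
  seq (recip x 0<x) k ℚ.≤ ℚLemmas.inv p 0<p
recip≤inv x (δ , 0<δ , _) k p 0<p p≤x = ℚLemmas.inv-anti 0<p (⊔-pos 0<δ (seq x k))
  (ℚP.≤-trans p≤x (ℚP.p≤p⊔q (seq x k) δ))

0≤recip : ∀ x (0<x : 0ℝ < x) k → 0ℚ ℚ.≤ seq (recip x 0<x) k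
0≤recip x (δ , 0<δ , _) k = ℚP.<⇒≤ (ℚLemmas.inv-pos (seq x k ℚ.⊔ δ) (⊔-pos 0<δ (seq x k)))

recip-πR : ∀ R .{{_ : NonZero R}} m → suc (double m) ℕ.≤ R → ∀ k → 19 ℕ.≤ k →
  seq (recip (π * fromℕ R) (π*ℕ-pos R)) k ℚ.≤ ½ ℚ.* 1/[1+2× m ]
recip-πR R m h k 19≤k = subst (seq (recip (π * fromℕ R) (π*ℕ-pos R)) k ℚ.≤_) eq
  (recip≤inv (π * fromℕ R) (π*ℕ-pos R) k (ℤ.+ 2 / 1 ℚ.* 1+2× m) 0<2o
    (ℚLemmas.*-mono (ℚP.nonNegative⁻¹ (ℤ.+ 2 / 1)) 0≤R (2≤π k 19≤k) o≤R))
  where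
    0≤R : 0ℚ ℚ.≤ ℤ.+ R / 1
    0≤R = subst (0ℚ ℚ.≤_) (count≡/1 R) (0≤count R)
    o≤R : 1+2× m ℚ.≤ ℤ.+ R / 1
    o≤R = subst (1+2× m ℚ.≤_) (count≡/1 R) (count-mono h)
    0<2o : 0ℚ ℚ.< ℤ.+ 2 / 1 ℚ.* 1+2× m
    0<2o = ℚLemmas.*-pos (ℚP.positive⁻¹ (ℤ.+ 2 / 1)) (0<count (double m))
    i : ℚ
    i = ℚLemmas.inv (ℤ.+ 2 / 1 ℚ.* 1+2× m) 0<2o
    eq : i ≡ ½ ℚ.* 1/[1+2× m ]
    eq = trans (sym (1+2×-cancel′ m i)) (trans
      (solve 3 (λ o r i → r :* (o :* i) := con ½ :* (r :* ((con (ℤ.+ 2 / 1) :* o) :* i))) refl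
        (1+2× m) 1/[1+2× m ] i)
      (cong (½ ℚ.*_) (trans (cong (1/[1+2× m ] ℚ.*_) (ℚLemmas.*-inv (ℤ.+ 2 / 1 ℚ.* 1+2× m) 0<2o))
        (ℚP.*-identityʳ 1/[1+2× m ]))))

-- At one index beyond all three thresholds, the strict inequality gives v + ε ≤ 1/2 + c and the
-- nonnegativity of `w`, used with ε/2, gives 1/2 + c ≤ v + ε/2.
≮-½+x-y : ∀ (v x y w : ℝ) c → (∀ k → 19 ℕ.≤ k → seq x k ℚ.≤ c) → (∀ k → 0ℚ ℚ.≤ seq y k) →
  0ℝ ≤ w → (∀ k → seq w k ≡ seq v k ℚ.- (½ ℚ.+ c)) → ¬ (v < fromℚ ½ + x - y)
≮-½+x-y v x y w c x≤c 0≤y 0≤w w≡ (ε , 0<ε , N , v<) = ℚP.<-irrefl refl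
  (ℚP.<-≤-trans 0<δ (subst₂ ℚ._≤_
    (trans (cong (λ e → (seq v k ℚ.+ e) ℚ.- (seq v k ℚ.+ δ)) (sym (ℚLemmas.half+half ε)))
      (solve 2 (λ v d → (v :+ (d :+ d)) :- (v :+ d) := d) refl (seq v k) δ))
    (ℚP.+-inverseʳ (seq v k ℚ.+ δ))
    (ℚP.+-monoˡ-≤ (ℚ.- (seq v k ℚ.+ δ)) (ℚP.≤-trans v+ε≤½+c ½+c≤v+δ))))
  where
    δ : ℚ
    δ = ½ ℚ.* ε
    0<δ : 0ℚ ℚ.< δ
    0<δ = ℚLemmas.half-pos 0<ε
    M k : ℕ
    M = proj₁ (0≤w δ 0<δ)
    k = (M ℕ.⊔ N) ℕ.⊔ 19
    ½+c≤v+δ : ½ ℚ.+ c ℚ.≤ seq v k ℚ.+ δ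
    ½+c≤v+δ = subst₂ ℚ._≤_ (ℚP.+-identityʳ (½ ℚ.+ c))
      (trans (cong (λ t → (½ ℚ.+ c) ℚ.+ (t ℚ.+ δ)) (w≡ k))
        (solve 3 (λ c v d → c :+ ((v :- c) :+ d) := v :+ d) refl (½ ℚ.+ c) (seq v k) δ))
      (ℚP.+-monoʳ-≤ (½ ℚ.+ c) (proj₂ (0≤w δ 0<δ) k (≤l {M} (≤l {M ℕ.⊔ N} ℕP.≤-refl))))
    v+ε≤½+c : seq v k ℚ.+ ε ℚ.≤ ½ ℚ.+ c
    v+ε≤½+c = ℚP.≤-trans (v< k (≤r {M} (≤l {M ℕ.⊔ N} ℕP.≤-refl)))
      (subst (½ ℚ.+ seq x k ℚ.- seq y k ℚ.≤_) (ℚP.+-identityʳ (½ ℚ.+ c))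
        (ℚP.+-mono-≤ (ℚP.+-monoʳ-≤ ½ (x≤c k (≤r {M ℕ.⊔ N} ℕP.≤-refl)))
          (ℚP.neg-antimono-≤ (0≤y k))))

proposition4p2 : (R : ℕ) .{{_ : NonZero R}} (n : ℕ) (G : SimpleGraph n) .{{_ : NonZero (edgeCount G)}} (b : EdgeSigns G) (v : ℝ) →
    v < fromℚ ½ + recip (π * fromℕ R) (π*ℕ-pos R) - recip (fromℕ (2 ℕ.* R ℕ.^ 2)) (2*ℕ²-pos R) →
    ¬ (R ⊢ OBJ G b ≤ const v)
proposition4p2 R n G b v v< ⊢ =
  let (m , m≤R , R≤2m) = half-odd R in
  ≮-½+x-y v (recip (π * fromℕ R) (π*ℕ-pos R)) (recip (fromℕ (2 ℕ.* R ℕ.^ 2)) (2*ℕ²-pos R))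
    (PseudoExpectation.Ẽ (suc m) (signs b) (const v -ₚ OBJ G b)) (½ ℚ.* 1/[1+2× m ])
    (recip-πR R m m≤R) (0≤recip (fromℕ (2 ℕ.* R ℕ.^ 2)) (2*ℕ²-pos R))
    (PseudoExpectation.sound (suc m) (signs b) (signs-bounded b) R≤2m ⊢) (Ẽ-gap G b m v) v<
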